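{- Let $n\ge3$, let $id=12\cdots n\in\mathcal S_n$ and $v=1\,2\cdots(n-3)\,(n-1)\,(n-2)\,n\in\mathcal S_n$. For $u\in\mathcal S_n$ let $[u]_{sh}$ be its shift equivalence class and $[u]_{ss}$ its super-strong Wilf equivalence class in $\mathcal S_n$. Then $[u]_{sh}=[u]_{ss}$ if $u\sim_{ss}id$ or $u\sim_{ss}v$, and otherwise $[u]_{sh}=[u]_{ss}\sqcup[\tilde u]_{ss}$ (a disjoint union).
   Context: $\tilde u$ denotes the reversal $u_n\cdots u_1$ of $u=u_1\cdots u_n$. Rigid shift: for a word $u=u_1\cdots u_n$ over $\mathbb P$, an integer $h\ge0$ and an integer $t$ such that for every $i$ with $u_i>h$ we have $1\le i+t\le n$ and $u_{i+t}\ge h$, the word $v$ with $v_j=\min(u_j,h)+\max(u_{j-t}-h,0)$ (second term $0$ if $j-t\notin[n]$) is a rigid shift of $u$ (cutting the skyline diagram at height $h$ and rigidly translating the part above the cut by $t$ so that each moved column rests on a column of height $h$). Two words are shift equivalent if one can be obtained from the other by a finite sequence of rigid shifts and reversals. Super-strong Wilf equivalence: for finite words $u,w$ over $\mathbb P$, $j$ is an embedding index of $u$ in $w$ if $j+|u|-1\le|w|$ and $u_k\le w_{j+k-1}$ for all $k$; $Em(u,w)$ is the set of such $j$; $u\sim_{ss}v$ if there is a bijection $f$ of the set of finite words over $\mathbb P$ preserving length and sum of letters with $Em(u,w)=Em(v,f(w))$ for all $w$. -}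

module Defs where

open import Data.Integer as ℤ using (ℤ; +_; -[1+_]; 1ℤ)
open import Data.Irrelevant using ([_])
open import Data.List using (List; []; _∷_; _++_; applyUpTo; length; map; reverse; sum)
open import Data.List.Relation.Binary.Permutation.Propositional using (_↭_)
open import Data.Nat using (ℕ; zero; suc; _+_; _∸_; _⊓_; _≤_; _<_; NonZero)
open import Data.Product using (Σ-syntax; ∃₂; _×_)
open import Data.Refinement using (Refinement; Refinement-syntax; value; _,_)
open import Data.Sum using (_⊎_)
open import Function.Bundles using (_⤖_; module Bijection)
open import Level using (0ℓ)
open import Relation.Binary using (Rel)
open import Relation.Binary.Construct.Closure.ReflexiveTransitive using (Star)
open import Relation.Binary.PropositionalEquality using (_≡_)
open import Relation.Unary using (Pred; _≐_)

ℙ : Set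
ℙ = [ x ∈ ℕ ∣ NonZero x ]

pos : (x : ℕ) .{{_ : NonZero x}} → ℙ
pos x {{x≢0}} = x , [ x≢0 ]

Word : Set
Word = List ℙ

weight : Word → ℕ
weight w = sum (map value w)

-- letter u i is u_i with 1-based indexing, and 0 when i is not a position of u.
letter : Word → ℕ → ℕ
letter []      _             = 0
letter (_ ∷ _) zero          = 0
letter (a ∷ _) (suc zero)    = value a
letter (_ ∷ u) (suc (suc i)) = letter u (suc i)

-- The same with integer indices: the height of column i of the skyline
-- diagram, where columns outside 1, …, length u are empty.
column : Word → ℤ → ℕ
column u (+ i)    = letter u i
column u -[1+ _ ] = 0

_∈[1⋯_] : ℤ → ℕ → Set
i ∈[1⋯ n ] = (1ℤ ℤ.≤ i) × (i ℤ.≤ + n)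

-- RigidShiftAt h t u v: v is obtained from u by cutting at height h and
-- translating the upper part by t.  The hypothesis h < column u i already
-- forces i to be a position of u.  The truncated difference x ∸ h is
-- max(x − h, 0), which vanishes outside the word since x = 0 there.
record RigidShiftAt (h : ℕ) (t : ℤ) (u v : Word) : Set where
  field
    supported   : ∀ i → h < column u i →
                  ((i ℤ.+ t) ∈[1⋯ length u ]) × (h ≤ column u (i ℤ.+ t))
    same-length : length v ≡ length u
    shifted     : ∀ j → j ∈[1⋯ length u ] →
                  column v j ≡ (column u j ⊓ h) + (column u (j ℤ.- t) ∸ h)

RigidShift : Rel Word 0ℓ
RigidShift u v = ∃₂ λ h t → RigidShiftAt h t u v

ShiftStep : Rel Word 0ℓ
ShiftStep u v = RigidShift u v ⊎ (v ≡ reverse u)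

-- The reflexive transitive closure is already symmetric: the shift with data
-- (h , t) is undone by the one with data (h , - t).
_∼sh_ : Rel Word 0ℓ
_∼sh_ = Star ShiftStep

Em : Word → Word → Pred ℕ 0ℓ
Em u w j = (1 ≤ j) × (j + length u ∸ 1 ≤ length w) ×
           (∀ k → 1 ≤ k → k ≤ length u → letter u k ≤ letter w (j + k ∸ 1))

_∼ss_ : Rel Word 0ℓ
u ∼ss v = Σ[ f ∈ Word ⤖ Word ] (∀ w →
            let fw = Bijection.to f w in
            (length fw ≡ length w) × (weight fw ≡ weight w) × (Em u w ≐ Em v fw))

-- One-line notation: u ∈ 𝒮 n when its letters are 1, …, n in some order.
𝒮 : ℕ → Pred Word 0ℓ
𝒮 n u = map value u ↭ applyUpTo suc n

idWord : ℕ → Word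
idWord n = applyUpTo (λ i → pos (suc i)) n

-- With n = 3 + m: the word 1 2 ⋯ (n−3) (n−1) (n−2) n.
vWord : ℕ → Word
vWord m = idWord m ++ pos (2 + m) ∷ pos (1 + m) ∷ pos (3 + m) ∷ []

-- The class among all words over ℙ.
[_]sh : Word → Pred Word 0ℓ
[ u ]sh w = u ∼sh w

-- The class within 𝒮 n.
[_]ss-in_ : Word → ℕ → Pred Word 0ℓ
([ u ]ss-in n) w = 𝒮 n w × (u ∼ss w)

{-# OPTIONS --safe #-}
-- Let P_h(u) = { i : u_i > h } be the levels of u, and call u ≈ v when u and v
-- have the same length and every P_h(v) is a translate of P_h(u).
--
-- * A rigid shift translates the levels from its cut upwards and fixes the lower
--   ones.  Conversely, if u ≈ v then aligning the levels from the bottom up turns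
--   u into v by rigid shifts.
-- * A rigid shift by t > 0 at height h yields a super-strong equivalence: in a word
--   w, the positions reached by the moved part of u, placed at the offsets where
--   the part of u below h embeds, form a set A; extend the translation of A by t to
--   a permutation of positions of height at least h and permute the letters of w.
-- * Conversely, if u ∼ss v then for each finite set S of offsets the least weights of
--   words in which u, respectively v, embed at all offsets of S agree.  This weight
--   is Σ_h |P_h(u) + S|, and taking for S an interval and an interval without a
--   reflected copy of P_h(u) recovers P_h(u) up to translation, for h descending.
--
-- So on permutations ∼ss is ≈, and the shift class of u is the union of the ≈-classes
-- of u and of its reversal.  These meet iff every level of u is symmetric, which
-- happens iff all levels are intervals, or all but one that lacks the midpoint of
-- three consecutive positions.
module Submission where

open import Defs
open import Data.Bool using (Bool; true; false; if_then_else_; T)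
import Data.Empty as Empty
open import Data.Integer as ℤ using (ℤ; +_; -[1+_]; 0ℤ; 1ℤ)
import Data.Integer.Properties as ℤₚ
import Data.Integer.Tactic.RingSolver as ℤ-Solver
import Data.Irrelevant as Irrelevant
open import Data.List using ([]; _∷_; _++_; applyUpTo; length; map; reverse)
open import Data.List.Membership.Propositional using () renaming (_∈_ to _∈ₗ_)
open import Data.List.Membership.Propositional.Properties using (∈-∃++; ∈-applyUpTo⁺; ∈-applyUpTo⁻)
open import Data.List.Properties
  using (++-assoc; applyUpTo-∷ʳ; length-++; length-applyUpTo; length-map; length-reverse;
         map-++; map-applyUpTo; map-∘; reverse-involutive; unfold-reverse)
open import Data.List.Relation.Binary.Permutation.Propositional
  using (_↭_; prep; swap; ↭-refl; ↭-reflexive; ↭-sym; ↭-trans; ↭⇒↭ₛ)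
open import Data.List.Relation.Binary.Permutation.Propositional.Properties
  using (All-resp-↭; map⁺; shift; ++⁺ˡ; ∈-resp-↭; ↭-length; ↭-reverse)
import Data.List.Relation.Binary.Permutation.Setoid.Properties as Permutationₛ
open import Data.List.Relation.Unary.All as All using (All)
import Data.List.Relation.Unary.AllPairs as AllPairs
open import Data.List.Relation.Unary.Any using (here; there)
open import Data.List.Relation.Unary.Unique.Propositional using (Unique)
open import Data.List.Relation.Unary.Unique.Propositional.Properties using (applyUpTo⁺₁)
open import Data.Nat
  using (ℕ; zero; suc; pred; _+_; _∸_; _⊓_; _⊔_; _≤_; _<_; _≤ᵇ_; z≤n; s≤s; z<s; s<s;
         s≤s⁻¹; s<s⁻¹; _≤?_; _<?_; >-nonZero; >-nonZero⁻¹)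
open import Data.Nat.ListAction using (sum)
open import Data.Nat.ListAction.Properties using (sum-↭)
open import Data.Nat.Properties
import Data.Nat.Tactic.RingSolver as ℕ-Solver
open import Data.Product using (∃; _×_; _,_; proj₁; proj₂)
open import Data.Refinement using (value)
open import Data.Sum as Sum using (_⊎_; inj₁; inj₂)
open import Data.Unit using (tt)
open import Function using (Inverse; _∘_; const; id; mk⇔; mk↔ₛ′)
open import Function.Bundles using (module Bijection)
open import Function.Properties.Bijection using (⤖⇒↔)
open import Function.Properties.Inverse using (↔⇒⤖)
open import Relation.Binary using (tri<; tri≈; tri>)
open import Relation.Binary.Construct.Closure.ReflexiveTransitive as Star using (Star; ε; _◅_)
open import Relation.Binary.PropositionalEquality
open import Relation.Nullary using (¬_; Dec; yes; no; does; contradiction)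
open import Relation.Nullary.Decidable using (_×-dec_; dec-true; does-⇔)
open import Relation.Unary using (_∈_; _≐_; _∪_; _⊥_)

variable
  u v w : Word

-- Finite sums

∑ : ℕ → (ℕ → ℕ) → ℕ
∑ n f = sum (applyUpTo f n)

∑-cong : ∀ n {f g} → (∀ i → i < n → f i ≡ g i) → ∑ n f ≡ ∑ n g
∑-cong zero    eq = refl
∑-cong (suc n) eq = cong₂ _+_ (eq 0 z<s) (∑-cong n (λ i i<n → eq (suc i) (s<s i<n)))

∑-mono-≤ : ∀ n {f g} → (∀ i → i < n → f i ≤ g i) → ∑ n f ≤ ∑ n g
∑-mono-≤ zero    le = z≤n
∑-mono-≤ (suc n) le = +-mono-≤ (le 0 z<s) (∑-mono-≤ n (λ i i<n → le (suc i) (s<s i<n)))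

∑-mono-< : ∀ n {f g} → (∀ i → f i ≤ g i) → ∀ {k} → k < n → f k < g k → ∑ n f < ∑ n g
∑-mono-< (suc n) le {zero}  _   lt = +-mono-<-≤ lt (∑-mono-≤ n (λ i _ → le (suc i)))
∑-mono-< (suc n) le {suc k} k<n lt = +-mono-≤-< (le 0) (∑-mono-< n (le ∘ suc) (s<s⁻¹ k<n) lt)

∑-reflects-< : ∀ n {f g} → ∑ n f < ∑ n g → ∃ λ i → i < n × f i < g i
∑-reflects-< (suc n) {f} {g} lt with f 0 <? g 0
... | yes f₀<g₀ = 0 , z<s , f₀<g₀
... | no  f₀≮g₀ with ∑-reflects-< n (+-cancelˡ-< (g 0) _ _ (≤-<-trans (+-monoˡ-≤ _ (≮⇒≥ f₀≮g₀)) lt))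
...   | i , i<n , fi<gi = suc i , s<s i<n , fi<gi

∑-tight : ∀ n {f g} → (∀ i → f i ≤ g i) → ∑ n g ≤ ∑ n f → ∀ i → i < n → g i ≤ f i
∑-tight n le ge i i<n = ≮⇒≥ (λ lt → <⇒≱ (∑-mono-< n le i<n lt) ge)

∑-distrib-+ : ∀ n f g → ∑ n (λ i → f i + g i) ≡ ∑ n f + ∑ n g
∑-distrib-+ zero    f g = refl
∑-distrib-+ (suc n) f g = trans (cong (_+_ _) (∑-distrib-+ n (f ∘ suc) (g ∘ suc)))
  (interchange (f 0) (g 0) (∑ n (f ∘ suc)) (∑ n (g ∘ suc)))
  where
  interchange : ∀ a b c d → (a + b) + (c + d) ≡ (a + c) + (b + d)
  interchange = ℕ-Solver.solve-∀

∑-snoc : ∀ n f → f 0 + ∑ n (f ∘ suc) ≡ ∑ n f + f n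
∑-snoc zero    f = +-comm (f 0) 0
∑-snoc (suc n) f = trans (cong (_+_ (f 0)) (∑-snoc n (f ∘ suc))) (sym (+-assoc (f 0) _ _))

-- The sums differ only in their terms at `x`; writing this additively avoids truncated subtraction.
∑-update : ∀ n {f g} x → x < n → (∀ i → i ≢ x → f i ≡ g i) → ∑ n f + g x ≡ ∑ n g + f x
∑-update (suc n) {f} {g} zero x<n eq
  rewrite ∑-cong n {f ∘ suc} {g ∘ suc} (λ i _ → eq (suc i) (λ ())) = swap-ends (f 0) _ (g 0)
  where
  swap-ends : ∀ a s b → (a + s) + b ≡ (b + s) + a
  swap-ends = ℕ-Solver.solve-∀
∑-update (suc n) {f} {g} (suc x) x<n eq
  rewrite eq 0 (λ ()) | +-assoc (g 0) (∑ n (f ∘ suc)) (g (suc x)) | +-assoc (g 0) (∑ n (g ∘ suc)) (f (suc x))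
  = cong (_+_ (g 0)) (∑-update n x (s<s⁻¹ x<n) (λ i i≢x → eq (suc i) (i≢x ∘ suc-injective)))

-- Sums over a window of integers

∑ᶻ : ℕ → (ℤ → ℕ) → ℕ
∑ᶻ n F = ∑ n (λ i → F (+ suc i))

SupportedIn : ℕ → (ℤ → ℕ) → Set
SupportedIn n F = ∀ i → 0 < F i → i ∈[1⋯ n ]

i+t-t : ∀ i t → i ℤ.+ t ℤ.- t ≡ i
i+t-t = ℤ-Solver.solve-∀

i-t+t : ∀ i t → i ℤ.- t ℤ.+ t ≡ i
i-t+t = ℤ-Solver.solve-∀

vanishes : ∀ {n F i} → SupportedIn n F → ¬ (i ∈[1⋯ n ]) → F i ≡ 0
vanishes supp i∉ = n≤0⇒n≡0 (≮⇒≥ (i∉ ∘ supp _))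

-- Each unit step drops the first term and gains one that vanishes.
shiftʳ-≤ : ∀ n {f : ℕ → ℕ} → (∀ i → n ≤ i → f i ≡ 0) → ∀ k → ∑ n (λ i → f (i + k)) ≤ ∑ n f
shiftʳ-≤ n {f} van zero    = ≤-reflexive (∑-cong n (λ i _ → cong f (+-identityʳ i)))
shiftʳ-≤ n {f} van (suc k) = begin
  ∑ n (λ i → f (i + suc k))   ≡⟨ ∑-cong n (λ i _ → cong f (+-suc i k)) ⟩
  ∑ n (λ i → f (suc (i + k))) ≤⟨ shiftʳ-≤ n (λ i n≤i → van (suc i) (m≤n⇒m≤1+n n≤i)) k ⟩
  ∑ n (f ∘ suc)               ≤⟨ m≤n+m _ (f 0) ⟩
  f 0 + ∑ n (f ∘ suc)         ≡⟨ ∑-snoc n f ⟩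
  ∑ n f + f n                 ≡⟨ cong (_+_ _) (van n ≤-refl) ⟩
  ∑ n f + 0                   ≡⟨ +-identityʳ _ ⟩
  ∑ n f                       ∎
  where open ≤-Reasoning

shiftˡ-≤ : ∀ n {F : ℤ → ℕ} → (∀ i → i ℤ.≤ 0ℤ → F i ≡ 0) → ∀ k → ∑ᶻ n (λ i → F (i ℤ.- + k)) ≤ ∑ᶻ n F
shiftˡ-≤ n {F} van zero    = ≤-reflexive (∑-cong n (λ i _ → cong F (ℤₚ.+-identityʳ _)))
shiftˡ-≤ n {F} van (suc k) = begin
  ∑ᶻ n (λ i → F (i ℤ.- + suc k))              ≡⟨ ∑-cong n (λ i _ → cong F (regroup (+ suc i) (+ k))) ⟩
  ∑ n f                                       ≤⟨ m≤m+n _ (f n) ⟩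
  ∑ n f + f n                                 ≡⟨ sym (∑-snoc n f) ⟩
  f 0 + ∑ n (f ∘ suc)                         ≡⟨ cong (λ x → x + ∑ n (f ∘ suc)) (van _ (ℤₚ.i≤j⇒i-j≤0 {+ 0} {+ k} (ℤ.+≤+ z≤n))) ⟩
  ∑ᶻ n (λ i → F (i ℤ.- + k))                  ≤⟨ shiftˡ-≤ n van k ⟩
  ∑ᶻ n F                                      ∎
  where
  open ≤-Reasoning
  f : ℕ → ℕ
  f i = F (+ i ℤ.- + k)
  regroup : ∀ i k → i ℤ.- (1ℤ ℤ.+ k) ≡ (i ℤ.- 1ℤ) ℤ.- k
  regroup = ℤ-Solver.solve-∀

-- Terms may leave the window, but none enter it from outside the support. Equality can fail;
-- `∑δ-translate` gets it by translating both ways between two supported functions.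
∑ᶻ-shift-≤ : ∀ n {F} → SupportedIn n F → ∀ t → ∑ᶻ n (λ i → F (i ℤ.+ t)) ≤ ∑ᶻ n F
∑ᶻ-shift-≤ n {F} supp (+ k)    = shiftʳ-≤ n (λ i n≤i → vanishes supp (λ (_ , i≤n) → <⇒≱ (s≤s n≤i) (ℤₚ.drop‿+≤+ i≤n))) k
∑ᶻ-shift-≤ n {F} supp -[1+ k ] = shiftˡ-≤ n (λ i i≤0 → vanishes supp (λ (1≤i , _) → 1≰0 (ℤₚ.≤-trans 1≤i i≤0))) (suc k)
  where
  1≰0 : ¬ (1ℤ ℤ.≤ 0ℤ)
  1≰0 (ℤ.+≤+ ())

-- The indicator of `k < m`

δ : ℕ → ℕ → ℕ
δ _       zero    = 0
δ zero    (suc m) = 1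
δ (suc k) (suc m) = δ k m

δ-pos : ∀ {k m} → k < m → δ k m ≡ 1
δ-pos {zero}  {suc m} _   = refl
δ-pos {suc k} {suc m} k<m = δ-pos (s<s⁻¹ k<m)

δ-pos⁻¹ : ∀ {k m} → 0 < δ k m → k < m
δ-pos⁻¹ {zero}  {suc m} _ = z<s
δ-pos⁻¹ {suc k} {suc m} p = s<s (δ-pos⁻¹ p)

δ-zero : ∀ {k m} → m ≤ k → δ k m ≡ 0
δ-zero m≤k = n≤0⇒n≡0 (≮⇒≥ (λ p → <⇒≱ (δ-pos⁻¹ p) m≤k))

δ-mono : ∀ {k m k′ m′} → (k < m → k′ < m′) → δ k m ≤ δ k′ m′
δ-mono {k} {m} imp with k <? m
... | yes k<m = ≤-reflexive (trans (δ-pos k<m) (sym (δ-pos (imp k<m))))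
... | no  k≮m = ≤-trans (≤-reflexive (δ-zero (≮⇒≥ k≮m))) z≤n

-- Splits off the layer just above height `k`; summed over columns, this separates the size of one
-- level from the contribution of the higher ones.
∸-δ : ∀ k m → m ∸ k ≡ (m ∸ suc k) + δ k m
∸-δ zero    zero    = refl
∸-δ zero    (suc m) = +-comm 1 m
∸-δ (suc k) zero    = refl
∸-δ (suc k) (suc m) = ∸-δ k m

∑δ-translate : ∀ n k {F G : ℤ → ℕ} → SupportedIn n F → SupportedIn n G → ∀ t →
               (∀ i → (k < F i → k < G (i ℤ.+ t)) × (k < G (i ℤ.+ t) → k < F i)) →
               ∑ᶻ n (δ k ∘ F) ≡ ∑ᶻ n (δ k ∘ G)
∑δ-translate n k {F} {G} suppF suppG t eqv = ≤-antisym
  (≤-trans (∑-mono-≤ n (λ i _ → δ-mono {m = F (+ suc i)} (proj₁ (eqv _)))) (∑ᶻ-shift-≤ n (supp suppG) t))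
  (≤-trans (∑-mono-≤ n (λ i _ → δ-mono {m = G (+ suc i)} (λ lt → proj₂ (eqv _) (subst (λ j → k < G j) (sym (i-t+t _ t)) lt))))
           (∑ᶻ-shift-≤ n (supp suppF) (ℤ.- t)))
  where
  supp : ∀ {F} → SupportedIn n F → SupportedIn n (δ k ∘ F)
  supp s i p = s i (≤-<-trans z≤n (δ-pos⁻¹ p))

-- Words

letter-0 : ∀ u → letter u 0 ≡ 0
letter-0 []      = refl
letter-0 (_ ∷ _) = refl

value-pos : ∀ (a : ℙ) → 0 < value a
value-pos record { value = x ; proof = Irrelevant.[ x≢0 ] } = >-nonZero⁻¹ x {{x≢0}}

value-injective : ∀ {a b : ℙ} → value a ≡ value b → a ≡ b
value-injective refl = refl

letter-> : ∀ u i → length u ≤ i → letter u (suc i) ≡ 0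
letter-> []      i       _    = refl
letter-> (a ∷ u) (suc i) u≤i = letter-> u i (s≤s⁻¹ u≤i)

letter-pos : ∀ u i → i < length u → 0 < letter u (suc i)
letter-pos (a ∷ u) zero    _   = value-pos a
letter-pos (a ∷ u) (suc i) i<u = letter-pos u i (s<s⁻¹ i<u)

letter-ext : ∀ u v → length u ≡ length v → (∀ i → i < length u → letter u (suc i) ≡ letter v (suc i)) → u ≡ v
letter-ext []      []      _   _  = refl
letter-ext (a ∷ u) (b ∷ v) len eq = cong₂ _∷_ (value-injective (eq 0 z<s))
  (letter-ext u v (suc-injective len) (λ i i<u → eq (suc i) (s<s i<u)))

letter-applyUpTo : ∀ (f : ℕ → ℙ) n i → i < n → letter (applyUpTo f n) (suc i) ≡ value (f i)
letter-applyUpTo f (suc n) zero    _   = refl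
letter-applyUpTo f (suc n) (suc i) i<n = letter-applyUpTo (f ∘ suc) n i (s<s⁻¹ i<n)

letter-++ˡ : ∀ u v i → i < length u → letter (u ++ v) (suc i) ≡ letter u (suc i)
letter-++ˡ (a ∷ u) v zero    _   = refl
letter-++ˡ (a ∷ u) v (suc i) i<u = letter-++ˡ u v i (s<s⁻¹ i<u)

letter-++ʳ : ∀ u v i → letter (u ++ v) (suc (length u + i)) ≡ letter v (suc i)
letter-++ʳ []      v i = refl
letter-++ʳ (a ∷ u) v i = letter-++ʳ u v i

letter-reverse : ∀ u i j → suc (i + j) ≡ length u → letter (reverse u) (suc i) ≡ letter u (suc j)
letter-reverse (a ∷ u) i zero eq rewrite unfold-reverse a u | +-identityʳ i | suc-injective eq
  with len ← length-reverse u
  = trans (cong (λ k → letter (reverse u ++ a ∷ []) (suc k)) (sym (trans (+-identityʳ _) len)))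
          (letter-++ʳ (reverse u) (a ∷ []) 0)
letter-reverse (a ∷ u) i (suc j) eq rewrite unfold-reverse a u | +-suc i j
  = trans (letter-++ˡ (reverse u) (a ∷ []) i
             (subst (i <_) (trans (suc-injective eq) (sym (length-reverse u))) (s≤s (m≤m+n i j))))
          (letter-reverse u i j (suc-injective eq))

sum-map≡∑ : ∀ (f : ℕ → ℕ) u → sum (map (f ∘ value) u) ≡ ∑ (length u) (λ i → f (letter u (suc i)))
sum-map≡∑ f []      = refl
sum-map≡∑ f (a ∷ u) = cong (_+_ (f (value a))) (sum-map≡∑ f u)

-- The word of length n whose letter at position i + 1 is g i, raised to 1 where g i = 0.
word : ℕ → (ℕ → ℕ) → Word
word n g = applyUpTo (λ i → pos (suc (pred (g i)))) n

length-word : ∀ n g → length (word n g) ≡ n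
length-word n g = length-applyUpTo _ n

letter-word : ∀ n g i → i < n → letter (word n g) (suc i) ≡ suc (pred (g i))
letter-word n g = letter-applyUpTo _ n

weight-word : ∀ n g → weight (word n g) ≡ ∑ n (suc ∘ pred ∘ g)
weight-word n g = cong sum (map-applyUpTo _ value n)

column-supported : ∀ u → SupportedIn (length u) (column u)
column-supported u (+ zero)  lt = contradiction (letter-0 u) (m<n⇒n≢0 lt)
column-supported u (+ suc i) lt = ℤ.+≤+ (s≤s z≤n) , ℤ.+≤+ (≰⇒> (λ u≤i → m<n⇒n≢0 lt (letter-> u i u≤i)))

in-window : ∀ {n i} → i ∈[1⋯ n ] → ∃ λ k → k < n × i ≡ + suc k
in-window {i = + suc k} (_ , ℤ.+≤+ k<n) = k , k<n , refl
in-window {i = + zero}  (ℤ.+≤+ () , _)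

column-pos : ∀ u {i} → i ∈[1⋯ length u ] → 0 < column u i
column-pos u i∈ with in-window i∈
... | k , k<u , refl = letter-pos u k k<u

-- Levels up to translation

Translated : ℕ → ℤ → Word → Word → Set
Translated h t u v = ∀ i → (h < column u i → h < column v (i ℤ.+ t)) × (h < column v (i ℤ.+ t) → h < column u i)

infix 4 _≈_
record _≈_ (u v : Word) : Set where
  field
    length-≡ : length u ≡ length v
    levels      : ∀ h → ∃ λ t → Translated h t u v
open _≈_

Translated-sym : ∀ {h t} → Translated h t u v → Translated h (ℤ.- t) v u
Translated-sym {u} {v} {h} {t} tr i =
  (λ lt → proj₂ (tr (i ℤ.- t)) (subst (λ j → h < column v j) (sym (i-t+t i t)) lt)) ,
  (λ lt → subst (λ j → h < column v j) (i-t+t i t) (proj₁ (tr (i ℤ.- t)) lt))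

Translated-trans : ∀ {h s t} → Translated h s u v → Translated h t v w → Translated h (s ℤ.+ t) u w
Translated-trans {w = w} {h} {s} {t} tr tr′ i rewrite sym (ℤₚ.+-assoc i s t) =
  proj₁ (tr′ (i ℤ.+ s)) ∘ proj₁ (tr i) , proj₂ (tr i) ∘ proj₂ (tr′ (i ℤ.+ s))

≈-sym : u ≈ v → v ≈ u
≈-sym {u} {v} u≈v = record
  { length-≡ = sym (length-≡ u≈v)
  ; levels      = λ h → _ , Translated-sym {u} {v} (proj₂ (levels u≈v h))
  }

≈-trans : u ≈ v → v ≈ w → u ≈ w
≈-trans {u} {v} {w} u≈v v≈w = record
  { length-≡ = trans (length-≡ u≈v) (length-≡ v≈w)
  ; levels      = λ h → _ , Translated-trans {u} {v} {w} (proj₂ (levels u≈v h)) (proj₂ (levels v≈w h))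
  }

-- RigidShiftAt with the sum in the field shifted resolved: j is covered by a
-- moved column exactly when h < column u (j - t).  This form is symmetric.
record Lifted (h : ℕ) (t : ℤ) (u v : Word) : Set where
  field
    same-length : length v ≡ length u
    moved       : ∀ i → h < column u i → (h ≤ column u (i ℤ.+ t)) × (column v (i ℤ.+ t) ≡ column u i)
    kept        : ∀ j → column u (j ℤ.- t) ≤ h → column v j ≡ column u j ⊓ h

_∈?[1⋯_] : ∀ i n → Dec (i ∈[1⋯ n ])
i ∈?[1⋯ n ] = (1ℤ ℤ.≤? i) ×-dec (i ℤ.≤? + n)

column-outside : ∀ u {i} → ¬ (i ∈[1⋯ length u ]) → column u i ≡ 0
column-outside u = vanishes (column-supported u)

rigid⇒lifted : ∀ {h t} → RigidShiftAt h t u v → Lifted h t u v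
rigid⇒lifted {u} {v} {h} {t} r = record { same-length = r.same-length ; moved = moved ; kept = kept }
  where
  module r = RigidShiftAt r
  moved : ∀ i → h < column u i → (h ≤ column u (i ℤ.+ t)) × (column v (i ℤ.+ t) ≡ column u i)
  moved i lt with i+t∈ , h≤ ← r.supported i lt = h≤ , (begin
    column v (i ℤ.+ t)                                              ≡⟨ r.shifted _ i+t∈ ⟩
    (column u (i ℤ.+ t) ⊓ h) + (column u (i ℤ.+ t ℤ.- t) ∸ h)       ≡⟨ cong₂ (λ x j → x + (column u j ∸ h)) (m≥n⇒m⊓n≡n h≤) (i+t-t i t) ⟩
    h + (column u i ∸ h)                                            ≡⟨ m+[n∸m]≡n (<⇒≤ lt) ⟩
    column u i                                                      ∎)
    where open ≡-Reasoning
  kept : ∀ j → column u (j ℤ.- t) ≤ h → column v j ≡ column u j ⊓ h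
  kept j le with j ∈?[1⋯ length u ]
  ... | yes j∈ = trans (r.shifted j j∈) (trans (cong (_+_ _) (m≤n⇒m∸n≡0 le)) (+-identityʳ _))
  ... | no  j∉ rewrite column-outside u j∉
    = column-outside v (j∉ ∘ subst (j ∈[1⋯_]) r.same-length)

module _ {h t} (l : Lifted h t u v) where
  open Lifted l

  covered : ∀ j → h < column u (j ℤ.- t) → (h ≤ column u j) × (column v j ≡ column u (j ℤ.- t))
  covered j lt = subst (λ i → (h ≤ column u i) × (column v i ≡ column u (j ℤ.- t))) (i-t+t j t) (moved (j ℤ.- t) lt)

  -- A covered position has height at least `h` before and after the shift; an uncovered one is
  -- merely capped at `h`.
  lifted-⊓ : ∀ j → column v j ⊓ h ≡ column u j ⊓ h
  lifted-⊓ j with h <? column u (j ℤ.- t)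
  ... | no  h≮ = trans (cong (_⊓ h) (kept j (≮⇒≥ h≮))) (trans (⊓-assoc _ h h) (cong (column u j ⊓_) (⊓-idem h)))
  ... | yes h< with le , eq ← covered j h< = trans (cong (_⊓ h) eq) (trans (m≥n⇒m⊓n≡n (<⇒≤ h<)) (sym (m≥n⇒m⊓n≡n le)))

  lifted-sym : Lifted h (ℤ.- t) v u
  lifted-sym = record { same-length = sym same-length ; moved = moved′ ; kept = kept′ }
    where
    moved′ : ∀ i → h < column v i → (h ≤ column v (i ℤ.- t)) × (column u (i ℤ.- t) ≡ column v i)
    moved′ i lt with h <? column u (i ℤ.- t)
    ... | no  h≮ = contradiction (≤-trans (≤-reflexive (kept i (≮⇒≥ h≮))) (m⊓n≤n _ h)) (<⇒≱ lt)
    ... | yes h< with _ , eq ← covered i h< =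
      ≤-trans (≤-reflexive (trans (sym (m≥n⇒m⊓n≡n (<⇒≤ h<))) (sym (lifted-⊓ (i ℤ.- t))))) (m⊓n≤m _ h) , sym eq
    kept′ : ∀ j → column v (j ℤ.- (ℤ.- t)) ≤ h → column u j ≡ column v j ⊓ h
    kept′ j le rewrite ℤₚ.neg-involutive t = trans (sym (m≤n⇒m⊓n≡m (≮⇒≥ low))) (sym (lifted-⊓ j))
      where
      low : ¬ (h < column u j)
      low lt = <⇒≱ (subst (h <_) (sym (proj₂ (moved j lt))) lt) le

  lifted⇒translated : ∀ {k} → h ≤ k → Translated k t u v
  lifted⇒translated {k} h≤k i =
    (λ lt → subst (k <_) (sym (proj₂ (moved i (≤-<-trans h≤k lt)))) lt) , back
    where
    back : k < column v (i ℤ.+ t) → k < column u i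
    back lt with h <? column u i
    ... | yes h< = subst (k <_) (proj₂ (moved i h<)) lt
    ... | no  h≮ = contradiction
      (≤-trans (≤-reflexive (kept (i ℤ.+ t) (subst (λ j → column u j ≤ h) (sym (i+t-t i t)) (≮⇒≥ h≮)))) (≤-trans (m⊓n≤n _ h) h≤k))
      (<⇒≱ lt)

  lifted⇒same-below : ∀ {k} → k < h → ∀ i → (k < column u i → k < column v i) × (k < column v i → k < column u i)
  lifted⇒same-below k<h i =
    (λ lt → <-≤-trans (⊓-pres-m< lt k<h) (≤-trans (≤-reflexive (sym (lifted-⊓ i))) (m⊓n≤m _ h))) ,
    (λ lt → <-≤-trans (⊓-pres-m< lt k<h) (≤-trans (≤-reflexive (lifted-⊓ i)) (m⊓n≤m _ h)))

  lifted⇒≈ : u ≈ v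
  lifted⇒≈ = record { length-≡ = sym same-length ; levels = levels′ }
    where
    levels′ : ∀ k → ∃ λ t → Translated k t u v
    levels′ k with h ≤? k
    ... | yes h≤k = t , lifted⇒translated h≤k
    ... | no  h≰k = 0ℤ , λ i → subst (λ j → (k < column u i → k < column v j) × (k < column v j → k < column u i))
                                 (sym (ℤₚ.+-identityʳ i)) (lifted⇒same-below (≰⇒> h≰k) i)

-- Aligning levels by rigid shifts

column-word : ∀ n {F} → (∀ {i} → i ∈[1⋯ n ] → 0 < F i) → SupportedIn n F →
              ∀ i → column (word n (λ k → F (+ suc k))) i ≡ F i
column-word n {F} F-pos supp i with i ∈?[1⋯ n ]
... | no  i∉ = trans (column-outside (word n (F ∘ +_ ∘ suc)) (i∉ ∘ subst (i ∈[1⋯_]) (length-word n (F ∘ +_ ∘ suc)))) (sym (vanishes supp i∉))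
... | yes i∈ with k , k<n , refl ← in-window i∈ = trans (letter-word n (F ∘ +_ ∘ suc) k k<n) (suc-pred (F (+ suc k)) {{>-nonZero (F-pos i∈)}})

-- A crude bound on heights, which tells the inductions over levels where to stop.
column-≤-weight : ∀ u i → column u i ≤ weight u
column-≤-weight u       -[1+ _ ]          = z≤n
column-≤-weight []      (+ _)             = z≤n
column-≤-weight (a ∷ u) (+ zero)          = z≤n
column-≤-weight (a ∷ u) (+ suc zero)      = m≤m+n _ _
column-≤-weight (a ∷ u) (+ suc (suc i))   = ≤-trans (column-≤-weight u (+ suc i)) (m≤n+m _ _)

SameBelow : ℕ → Word → Word → Set
SameBelow H u v = ∀ {h} → h < H → ∀ i → (h < column u i → h < column v i) × (h < column v i → h < column u i)

same-below⇒≡ : ∀ {H} → length u ≡ length v → (∀ i → column v i < H) → SameBelow H u v → u ≡ v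
same-below⇒≡ {u} {v} len bound same = letter-ext u v len (λ i _ → column-≡ (+ suc i))
  where
  column-≡ : ∀ i → column u i ≡ column v i
  column-≡ i = ≤-antisym
    (≮⇒≥ (λ lt → <-irrefl refl (proj₁ (same (bound i) i) lt)))
    (≮⇒≥ (λ lt → <-irrefl refl (proj₂ (same (<-trans lt (bound i)) i) lt)))

-- If u and v agree below H, the translation taking level H of u to level H of v
-- rests on columns of height at least H, so it is a rigid shift of u.
align-level : ∀ H → 0 < H → u ≈ v → SameBelow H u v → ∃ λ w → RigidShift u w × SameBelow (suc H) w v
align-level {u} {v} H 0<H u≈v same = shiftedWord , (H , t , rigid) , same′
  where
  n = length u
  t = proj₁ (levels u≈v H)
  tr = proj₂ (levels u≈v H)
  F : ℤ → ℕ
  F j = (column u j ⊓ H) + (column u (j ℤ.- t) ∸ H)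
  F-pos : ∀ {i} → i ∈[1⋯ n ] → 0 < F i
  F-pos i∈ = <-≤-trans (⊓-pres-m< (column-pos u i∈) 0<H) (m≤m+n _ _)
  F-supp : SupportedIn n F
  F-supp i lt with i ∈?[1⋯ n ]
  ... | yes i∈ = i∈
  ... | no  i∉ rewrite column-outside u i∉ = subst (i ∈[1⋯_]) (sym (length-≡ u≈v))
    (column-supported v i (≤-<-trans z≤n (subst (λ j → H < column v j) (i-t+t i t) (proj₁ (tr (i ℤ.- t)) (m∸n≢0⇒n<m (m<n⇒n≢0 lt))))))
  shiftedWord : Word
  shiftedWord = word n (λ k → F (+ suc k))
  pred-H : ∀ {m} → m < H → suc (pred H) ≡ H
  pred-H m<H = suc-pred H {{>-nonZero (≤-<-trans z≤n m<H)}}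
  rests : ∀ i → H < column u i → H ≤ column u (i ℤ.+ t)
  -- The column of `v` at `i + t` exceeds `H`, so it lies in the level above `pred H`, where `u` and
  -- `v` agree.
  rests i lt = subst (_≤ column u (i ℤ.+ t)) (pred-H 0<H)
    (proj₂ (same (≤-reflexive (pred-H 0<H)) (i ℤ.+ t)) (≤-trans (≤-reflexive (pred-H 0<H)) (<⇒≤ (proj₁ (tr i) lt))))
  rigid : RigidShiftAt H t u shiftedWord
  rigid = record
    { supported   = λ i lt → subst ((i ℤ.+ t) ∈[1⋯_]) (sym (length-≡ u≈v))
                               (column-supported v (i ℤ.+ t) (≤-<-trans z≤n (proj₁ (tr i) lt))) , rests i lt
    ; same-length = length-word n (λ k → F (+ suc k))
    ; shifted     = λ j _ → column-word n F-pos F-supp j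
    }
  lifted = rigid⇒lifted rigid
  same′ : SameBelow (suc H) shiftedWord v
  same′ {h} h<1+H i with m≤n⇒m<n∨m≡n (s≤s⁻¹ h<1+H)
  ... | inj₁ h<H = proj₁ (same h<H i) ∘ proj₂ (lifted⇒same-below lifted h<H i) , proj₁ (lifted⇒same-below lifted h<H i) ∘ proj₂ (same h<H i)
  -- At height `H` both `shiftedWord` and `v` have the translate by `t` of the level of `u`; the two
  -- are compared through position `i - t` of `u`.
  ... | inj₂ refl with lifted⇒translated lifted ≤-refl (i ℤ.- t) | tr (i ℤ.- t)
  ...   | e | e′ rewrite i-t+t i t = proj₁ e′ ∘ proj₂ e , proj₁ e ∘ proj₂ e′

-- Alignment starts at height 1, because level 0 consists of all positions, and ends when the height
-- exceeds the weight of `v` and hence all its columns.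
≈⇒rigid* : u ≈ v → Star RigidShift u v
≈⇒rigid* {u} {v} u≈v = align (weight v) 1 z<s (≤-reflexive (+-comm 1 (weight v))) u≈v same-below-1
  where
  align : ∀ {u} k H → 0 < H → suc (weight v) ≤ k + H → u ≈ v → SameBelow H u v → Star RigidShift u v
  align zero    H _   B≤ u≈v same = subst (Star RigidShift _) (same-below⇒≡ (length-≡ u≈v) (λ i → ≤-<-trans (column-≤-weight v i) B≤) same) ε
  align (suc k) H 0<H B≤ u≈v same with w , r@(_ , _ , r′) , same′ ← align-level H 0<H u≈v same =
    r ◅ align k (suc H) z<s (≤-trans B≤ (≤-reflexive (sym (+-suc k H)))) (≈-trans (≈-sym (lifted⇒≈ (rigid⇒lifted r′))) u≈v) same′
  same-below-1 : SameBelow 1 u v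
  same-below-1 z<s i =
    (λ lt → column-pos v (subst (i ∈[1⋯_]) (length-≡ u≈v) (column-supported u i lt))) ,
    (λ lt → column-pos u (subst (i ∈[1⋯_]) (sym (length-≡ u≈v)) (column-supported v i lt)))

-- Level sizes and rearrangements

level-size : ℕ → Word → ℕ
level-size k u = sum (map (δ k) (map value u))

level-size≡∑ᶻ : ∀ k u → level-size k u ≡ ∑ᶻ (length u) (δ k ∘ column u)
level-size≡∑ᶻ k u = trans (cong sum (sym (map-∘ u))) (sum-map≡∑ (δ k) u)

≈⇒level-size : u ≈ v → ∀ k → level-size k u ≡ level-size k v
≈⇒level-size {u} {v} u≈v k = begin
  level-size k u                 ≡⟨ level-size≡∑ᶻ k u ⟩
  ∑ᶻ (length u) (δ k ∘ column u) ≡⟨ ∑δ-translate (length u) k (column-supported u)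
                                      (subst (λ n → SupportedIn n (column v)) (sym (length-≡ u≈v)) (column-supported v))
                                      _ (proj₂ (levels u≈v k)) ⟩
  ∑ᶻ (length u) (δ k ∘ column v) ≡⟨ cong (λ n → ∑ᶻ n (δ k ∘ column v)) (length-≡ u≈v) ⟩
  ∑ᶻ (length v) (δ k ∘ column v) ≡⟨ sym (level-size≡∑ᶻ k v) ⟩
  level-size k v                 ∎
  where open ≡-Reasoning

-- The indicators `δ k` and `δ (suc k)` differ only at the value `suc k`, so a drop between the two
-- sums must come from an entry with this value.
∈-by-level-size : ∀ {k ys} → sum (map (δ (suc k)) ys) < sum (map (δ k) ys) → suc k ∈ₗ ys
∈-by-level-size {k} {y ∷ ys} lt with y ≟ suc k
... | yes refl = here refl
... | no  y≢1+k = there (∈-by-level-size (+-cancelˡ-< (δ k y) _ _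
    (subst (λ x → x + sum (map (δ (suc k)) ys) < sum (map (δ k) (y ∷ ys))) δ-≡ lt)))
  where
  δ-≡ : δ (suc k) y ≡ δ k y
  δ-≡ = ≤-antisym (δ-mono {suc k} {y} {k} {y} (<-trans (n<1+n k)))
                  (δ-mono {k} {y} {suc k} {y} (λ k<y → ≤∧≢⇒< k<y (y≢1+k ∘ sym)))

level-sum-drops : ∀ k xs → sum (map (δ (suc k)) (suc k ∷ xs)) < sum (map (δ k) (suc k ∷ xs))
level-sum-drops k xs rewrite δ-zero {suc k} {suc k} ≤-refl | δ-pos (n<1+n k) = s≤s (mono xs)
  where
  mono : ∀ zs → sum (map (δ (suc k)) zs) ≤ sum (map (δ k) zs)
  mono []       = z≤n
  mono (z ∷ zs) = +-mono-≤ (δ-mono {suc k} {z} {k} {z} (<-trans (n<1+n k))) (mono zs)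

-- The head of `xs` makes the level sizes drop just below its value, so it also occurs in `ys`.
-- Deleting it on both sides keeps the level sizes equal.
level-sizes⇒↭ : ∀ xs ys → All (0 <_) xs → All (0 <_) ys →
                (∀ k → sum (map (δ k) xs) ≡ sum (map (δ k) ys)) → xs ↭ ys
level-sizes⇒↭ []       []       _ _ _ = ↭-refl
level-sizes⇒↭ []       (y ∷ ys) _ (0<y All.∷ _) eq = contradiction (trans (eq 0) (cong (λ x → x + sum (map (δ 0) ys)) (δ-pos 0<y))) (λ ())
level-sizes⇒↭ (suc k ∷ xs) ys (_ All.∷ pxs) pys eq
  with as , bs , refl ← ∈-∃++ (∈-by-level-size {k} {ys} (subst₂ _<_ (eq (suc k)) (eq k) (level-sum-drops k xs)))
  = ↭-trans (prep (suc k) (level-sizes⇒↭ xs (as ++ bs) pxs rest-pos rest)) (↭-sym (shift (suc k) as bs))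
  where
  rest-pos : All (0 <_) (as ++ bs)
  rest-pos with _ All.∷ p ← All-resp-↭ (shift (suc k) as bs) pys = p
  rest : ∀ j → sum (map (δ j) xs) ≡ sum (map (δ j) (as ++ bs))
  rest j = +-cancelˡ-≡ (δ j (suc k)) _ _ (trans (eq j) (sum-↭ (map⁺ (δ j) (shift (suc k) as bs))))

≈⇒↭ : u ≈ v → map value u ↭ map value v
≈⇒↭ {u} {v} u≈v = level-sizes⇒↭ (map value u) (map value v) (values-pos u) (values-pos v) (≈⇒level-size u≈v)
  where
  values-pos : ∀ u → All (0 <_) (map value u)
  values-pos []      = All.[]
  values-pos (a ∷ u) = value-pos a All.∷ values-pos u

-- Embedding at offset m, that is at the index m + 1.
Embeds : Word → Word → ℕ → Set
Embeds u w m = (m + length u ≤ length w) × (∀ k → letter u k ≤ letter w (m + k))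

Em⇒Embeds : ∀ u w {m} → Em u w (suc m) → Embeds u w m
Em⇒Embeds u w {m} (_ , fits , le) = fits , le′
  where
  le′ : ∀ k → letter u k ≤ letter w (m + k)
  le′ zero    = ≤-trans (≤-reflexive (letter-0 u)) z≤n
  le′ (suc k) with k <? length u
  ... | yes k<u = le (suc k) (s≤s z≤n) k<u
  ... | no  k≮u = ≤-trans (≤-reflexive (letter-> u k (≮⇒≥ k≮u))) z≤n

Embeds⇒Em : ∀ u w {m} → Embeds u w m → Em u w (suc m)
Embeds⇒Em u w (fits , le) = s≤s z≤n , fits , λ k _ _ → le k

-- Super-strong equivalence as an equivalence relation

mk∼ss : ∀ u v (f g : Word → Word) → (∀ w → f (g w) ≡ w) → (∀ w → g (f w) ≡ w) →
        (∀ w → length (f w) ≡ length w) → (∀ w → weight (f w) ≡ weight w) →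
        (∀ w {m} → Embeds u w m → Embeds v (f w) m) → (∀ w {m} → Embeds v (f w) m → Embeds u w m) → u ∼ss v
mk∼ss u v f g fg gf len wt to from = ↔⇒⤖ (mk↔ₛ′ f g fg gf) , λ w → len w , wt w ,
  (λ { {zero} (() , _) ; {suc m} e → Embeds⇒Em v (f w) (to w (Em⇒Embeds u w e)) }) ,
  (λ { {zero} (() , _) ; {suc m} e → Embeds⇒Em u w (from w (Em⇒Embeds v (f w) e)) })

∼ss-sym : u ∼ss v → v ∼ss u
∼ss-sym {u} {v} (f , spec) = ↔⇒⤖ (mk↔ₛ′ from to strictlyInverseʳ strictlyInverseˡ) , λ w →
  subst (λ w′ → (length (from w) ≡ length w′) × (weight (from w) ≡ weight w′)) (strictlyInverseˡ w)
    (let len , wt , _ = spec (from w) in sym len , sym wt) .proj₁ ,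
  subst (λ w′ → (length (from w) ≡ length w′) × (weight (from w) ≡ weight w′)) (strictlyInverseˡ w)
    (let len , wt , _ = spec (from w) in sym len , sym wt) .proj₂ ,
  (λ {m} e → proj₂ (proj₂ (proj₂ (spec (from w)))) (subst (λ w′ → Em v w′ m) (sym (strictlyInverseˡ w)) e)) ,
  (λ {m} e → subst (λ w′ → Em v w′ m) (strictlyInverseˡ w) (proj₁ (proj₂ (proj₂ (spec (from w)))) e))
  where open Inverse (⤖⇒↔ f)

∼ss-refl : u ∼ss u
∼ss-refl {u} = mk∼ss u u id id (λ _ → refl) (λ _ → refl) (λ _ → refl) (λ _ → refl) (λ _ e → e) (λ _ e → e)

∼ss-trans : u ∼ss v → v ∼ss w → u ∼ss w
∼ss-trans {u} {v} {w} (f , f-spec) (g , g-spec) =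
  ↔⇒⤖ (mk↔ₛ′ (G.to ∘ F.to) (F.from ∘ G.from)
    (λ x → trans (cong G.to (F.strictlyInverseˡ _)) (G.strictlyInverseˡ x))
    (λ x → trans (cong F.from (G.strictlyInverseʳ _)) (F.strictlyInverseʳ x))) , λ x →
  let lf , wf , ef , ef⁻¹ = f-spec x
      lg , wg , eg , eg⁻¹ = g-spec (F.to x)
  in trans lg lf , trans wg wf , (λ e → eg (ef e)) , (λ e → ef⁻¹ (eg⁻¹ e))
  where
  module F = Inverse (⤖⇒↔ f)
  module G = Inverse (⤖⇒↔ g)

-- Permutations of positions

transpose : ℕ → ℕ → ℕ → ℕ
transpose x y i with i ≟ x
... | yes _ = y
... | no  _ with i ≟ y
...   | yes _ = x
...   | no  _ = i

transpose-ˡ : ∀ x y → transpose x y x ≡ y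
transpose-ˡ x y with x ≟ x
... | yes _   = refl
... | no  x≢x = contradiction refl x≢x

transpose-ʳ : ∀ x y → transpose x y y ≡ x
transpose-ʳ x y with y ≟ x
... | yes eq = eq
... | no  _ with y ≟ y
...   | yes _   = refl
...   | no  y≢y = contradiction refl y≢y

transpose-fixes : ∀ x y {i} → i ≢ x → i ≢ y → transpose x y i ≡ i
transpose-fixes x y {i} i≢x i≢y with i ≟ x
... | yes i≡x = contradiction i≡x i≢x
... | no  _ with i ≟ y
...   | yes i≡y = contradiction i≡y i≢y
...   | no  _   = refl

transpose-involutive : ∀ x y i → transpose x y (transpose x y i) ≡ i
transpose-involutive x y i with i ≟ x
... | yes refl = transpose-ʳ x y
... | no  i≢x with i ≟ y
...   | yes refl = transpose-ˡ x y
...   | no  i≢y  = transpose-fixes x y i≢x i≢y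

-- A transposition is two one-point updates, passing through the function `k` that takes the value
-- `g y` at both `x` and `y`.
∑-transpose : ∀ n g x y → x ≢ y → x < n → y < n → ∑ n (g ∘ transpose x y) ≡ ∑ n g
∑-transpose n g x y x≢y x<n y<n = +-cancelʳ-≡ (g y) _ _ (begin
  ∑ n (g ∘ transpose x y) + g y                   ≡⟨ cong (_+_ _) k-y ⟨
  ∑ n (g ∘ transpose x y) + k y                   ≡⟨ ∑-update n y y<n off-y ⟩
  ∑ n k + g (transpose x y y)                     ≡⟨ cong (λ i → ∑ n k + g i) (transpose-ʳ x y) ⟩
  ∑ n k + g x                                     ≡⟨ ∑-update n x x<n off-x ⟩
  ∑ n g + k x                                     ≡⟨ cong (_+_ _) k-x ⟩
  ∑ n g + g y                                     ∎)
  where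
  open ≡-Reasoning
  k : ℕ → ℕ
  k i with i ≟ x
  ... | yes _ = g y
  ... | no  _ = g i
  k-x : k x ≡ g y
  k-x with x ≟ x
  ... | yes _   = refl
  ... | no  x≢x = contradiction refl x≢x
  off-x : ∀ i → i ≢ x → k i ≡ g i
  off-x i i≢x with i ≟ x
  ... | yes i≡x = contradiction i≡x i≢x
  ... | no  _   = refl
  k-y : k y ≡ g y
  k-y = off-x y (x≢y ∘ sym)
  off-y : ∀ i → i ≢ y → g (transpose x y i) ≡ k i
  off-y i i≢y with i ≟ x
  ... | yes _ = refl
  ... | no  _ with i ≟ y
  ...   | yes i≡y = contradiction i≡y i≢y
  ...   | no  _   = refl

-- perm A l sends x + t to x whenever A x and x ≤ l, so it extends the partial
-- translation from A to a permutation.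
module Permutation (d : ℕ) where
  t : ℕ
  t = suc d

  x≢x+t : ∀ x → x ≢ x + t
  x≢x+t x = m≢1+m+n x ∘ λ eq → trans eq (+-suc x d)

  step : (ℕ → Bool) → ℕ → ℕ → ℕ
  step A x i = if A x then transpose x (x + t) i else i

  perm perm⁻¹ : (ℕ → Bool) → ℕ → ℕ → ℕ
  perm   A zero    i = i
  perm   A (suc l) i = step A (suc l) (perm A l i)
  perm⁻¹ A zero    i = i
  perm⁻¹ A (suc l) i = perm⁻¹ A l (step A (suc l) i)

  step-involutive : ∀ A x i → step A x (step A x i) ≡ i
  step-involutive A x i with A x
  ... | true  = transpose-involutive x (x + t) i
  ... | false = refl

  perm-inverseˡ : ∀ A l i → perm A l (perm⁻¹ A l i) ≡ i
  perm-inverseˡ A zero    i = refl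
  perm-inverseˡ A (suc l) i = trans (cong (step A (suc l)) (perm-inverseˡ A l _)) (step-involutive A (suc l) i)

  perm-inverseʳ : ∀ A l i → perm⁻¹ A l (perm A l i) ≡ i
  perm-inverseʳ A zero    i = refl
  perm-inverseʳ A (suc l) i = trans (cong (perm⁻¹ A l) (step-involutive A (suc l) _)) (perm-inverseʳ A l i)

  step-cong : ∀ {A B} → (∀ x → A x ≡ B x) → ∀ x i → step A x i ≡ step B x i
  step-cong A≗B x i = cong (if_then transpose x (x + t) i else i) (A≗B x)

  perm-cong : ∀ {A B} → (∀ x → A x ≡ B x) → ∀ l i → perm A l i ≡ perm B l i
  perm-cong A≗B zero    i = refl
  perm-cong {A} A≗B (suc l) i = trans (cong (step A (suc l)) (perm-cong A≗B l i)) (step-cong A≗B (suc l) _)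

  perm⁻¹-cong : ∀ {A B} → (∀ x → A x ≡ B x) → ∀ l i → perm⁻¹ A l i ≡ perm⁻¹ B l i
  perm⁻¹-cong A≗B zero    i = refl
  perm⁻¹-cong {A} A≗B (suc l) i = trans (cong (perm⁻¹ A l) (step-cong A≗B (suc l) i)) (perm⁻¹-cong A≗B l _)

  step-fixes : ∀ A x {i} → i ≢ x → i ≢ x + t → step A x i ≡ i
  step-fixes A x i≢x i≢x+t with A x
  ... | true  = transpose-fixes x (x + t) i≢x i≢x+t
  ... | false = refl

  perm-beyond : ∀ A l x → l < x → perm A l (x + t) ≡ x + t
  perm-beyond A zero    x l<x = refl
  perm-beyond A (suc l) x l<x rewrite perm-beyond A l x (<-trans (n<1+n l) l<x) =
    step-fixes A (suc l) (>⇒≢ (<-≤-trans l<x (m≤m+n x t))) (λ eq → >⇒≢ l<x (+-cancelʳ-≡ t x (suc l) eq))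

  -- The step at `z` moves at most `z` and `z + t`. The steps before `x` therefore fix `x + t`, the
  -- step at `x` sends it to `x`, and the later ones fix `x`.
  perm-shift : ∀ A l x → A x ≡ true → 0 < x → x ≤ l → perm A l (x + t) ≡ x
  perm-shift A zero    zero    Ax () x≤l
  perm-shift A (suc l) x Ax 0<x x≤1+l with m≤n⇒m<n∨m≡n x≤1+l
  ... | inj₁ x<1+l rewrite perm-shift A l x Ax 0<x (s≤s⁻¹ x<1+l) =
    step-fixes A (suc l) (<⇒≢ x<1+l) (<⇒≢ (<-≤-trans x<1+l (m≤m+n (suc l) t)))
  ... | inj₂ refl rewrite perm-beyond A l x ≤-refl | Ax = transpose-ʳ x (x + t)

  module _ {B : Set} (P : ℕ → B) {A : ℕ → Bool} (inv : ∀ x → A x ≡ true → P x ≡ P (x + t)) where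
    -- Used with two choices of `P`: the height capped at the cut, and the property of being a
    -- position of the word.
    step-invariant : ∀ x i → P (step A x i) ≡ P i
    step-invariant x i with A x in Ax
    ... | false = refl
    ... | true with i ≟ x
    ...   | yes refl = sym (inv x Ax)
    ...   | no  _ with i ≟ x + t
    ...     | yes refl = inv x Ax
    ...     | no  _    = refl

    perm-invariant : ∀ l i → P (perm A l i) ≡ P i
    perm-invariant zero    i = refl
    perm-invariant (suc l) i = trans (step-invariant (suc l) _) (perm-invariant l i)

    perm⁻¹-invariant : ∀ l i → P (perm⁻¹ A l i) ≡ P i
    perm⁻¹-invariant zero    i = refl
    perm⁻¹-invariant (suc l) i = trans (perm⁻¹-invariant l _) (step-invariant (suc l) i)

  ∑-perm : ∀ n {A} → (∀ x → A x ≡ true → x + t < n) → ∀ l g → ∑ n (g ∘ perm A l) ≡ ∑ n g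
  ∑-perm n bound zero    g = refl
  ∑-perm n {A} bound (suc l) g = trans (∑-perm n bound l (g ∘ step A (suc l))) ∑-step
    where
    ∑-step : ∑ n (g ∘ step A (suc l)) ≡ ∑ n g
    ∑-step with A (suc l) in Ax
    ... | false = refl
    ... | true  = ∑-transpose n g (suc l) (suc l + t) (x≢x+t (suc l))
                    (≤-<-trans (m≤m+n (suc l) t) (bound (suc l) Ax)) (bound (suc l) Ax)

-- Rearranging the letters of a word

weight≡∑ : ∀ w → weight w ≡ ∑ (suc (length w)) (letter w)
weight≡∑ w = trans (sum-map≡∑ id w) (cong (λ x → x + ∑ (length w) (letter w ∘ suc)) (sym (letter-0 w)))

letter-pos⁻¹ : ∀ w {i} → 0 < letter w i → (0 < i) × (i ≤ length w)
letter-pos⁻¹ w {i} lt with column-supported w (+ i) lt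
... | ℤ.+≤+ 1≤i , ℤ.+≤+ i≤w = 1≤i , i≤w

permuted : (ℕ → ℕ) → Word → Word
permuted π w = word (length w) (λ i → letter w (π (suc i)))

-- By hypothesis `π` respects being a position of `w`, so `word` never has to raise a 0 to 1 and the
-- formula holds off the word as well.
letter-permuted : ∀ π w → (∀ i → δ 0 (letter w (π i)) ≡ δ 0 (letter w i)) → ∀ i → letter (permuted π w) i ≡ letter w (π i)
letter-permuted π w inv i = column-word (length w) {F} F-pos F-supp (+ i)
  where
  F : ℤ → ℕ
  F (+ i)    = letter w (π i)
  F -[1+ _ ] = 0
  F-pos : ∀ {i} → i ∈[1⋯ length w ] → 0 < F i
  F-pos {+ i} i∈ = δ-pos⁻¹ (subst (0 <_) (sym (inv i)) (≤-reflexive (sym (δ-pos (column-pos w i∈)))))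
  F-supp : SupportedIn (length w) F
  F-supp (+ i) lt = column-supported w (+ i) (δ-pos⁻¹ (subst (0 <_) (inv i) (≤-reflexive (sym (δ-pos lt)))))

-- A rigid shift by t > 0 of u moves the part of w above height h by t over the
-- positions that the lifted part of u reaches from offsets at which the part of
-- u below h embeds in w.  These offsets only depend on the part of w below h.
module _ {h d : ℕ} (l : Lifted h (+ suc d) u v) where
  open Lifted l
  open Permutation d

  private
    n = length u

    moved′ : ∀ {k} → h < letter u k → (h ≤ letter u (k + t)) × (letter v (k + t) ≡ letter u k)
    moved′ {k} = moved (+ k)

    kept′ : ∀ j → (∃ λ k → (j ≡ k + t) × (h < letter u k)) ⊎ (letter v j ≡ letter u j ⊓ h)
    kept′ j with h <? column u (+ j ℤ.- + t)
    ... | no  h≮ = inj₂ (kept (+ j) (≮⇒≥ h≮))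
    ... | yes h< with + j ℤ.- + t in eq
    ...   | + k = inj₁ (k , ℤₚ.+-injective (trans (sym (i-t+t (+ j) (+ t))) (cong (ℤ._+ + t) eq)) , h<)

  LowerEmbeds : Word → ℕ → Set
  LowerEmbeds w m = (m + n ≤ length w) × (∀ {k} → k < n → letter u (suc k) ⊓ h ≤ letter w (m + suc k))

  -- Truncation in `x ∸ m` is harmless: `letter u 0` is 0, so the last condition forces `m < x`. The
  -- bound on `m` makes the predicate decidable.
  Reached : Word → ℕ → Set
  Reached w x = ∃ λ m → m < suc (length w) × LowerEmbeds w m × h < letter u (x ∸ m)

  reached? : ∀ w x → Dec (Reached w x)
  reached? w x = anyUpTo? (λ m → ((m + n ≤? length w) ×-dec allUpTo? (λ k → letter u (suc k) ⊓ h ≤? letter w (m + suc k)) n)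
                                 ×-dec (h <? letter u (x ∸ m))) (suc (length w))

  reached : Word → ℕ → Bool
  reached w x = does (reached? w x)

  lower-letter : ∀ {w m} → LowerEmbeds w m → ∀ k → letter u k ⊓ h ≤ letter w (m + k)
  lower-letter _        zero    = ≤-trans (m⊓n≤m _ h) (≤-trans (≤-reflexive (letter-0 u)) z≤n)
  lower-letter (_ , le) (suc k) with k <? n
  ... | yes k<n = le k<n
  ... | no  k≮n = ≤-trans (m⊓n≤m _ h) (≤-trans (≤-reflexive (letter-> u k (≮⇒≥ k≮n))) z≤n)

  reached-true : ∀ w x → reached w x ≡ true → Reached w x
  reached-true w x eq with yes r ← reached? w x = r

  -- Write `x = m + k`. Column `k` of `u` exceeds `h` and is moved onto column `k + t`, which
  -- reaches `h`; since `u` capped at `h` embeds at `m`, so do the letters of `w` at `x` and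
  -- `x + t`.
  reached-heights : ∀ w x → reached w x ≡ true →
    (h ≤ letter w x) × (h ≤ letter w (x + t)) × (0 < x) × (x + t ≤ length w)
  reached-heights w x eq with m , _ , lower@(fits , _) , lt ← reached-true w x eq =
    subst (λ y → (h ≤ letter w y) × (h ≤ letter w (y + t)) × (0 < y) × (y + t ≤ length w)) m+k≡x
      ( ≤-trans (≤-reflexive (sym (m≥n⇒m⊓n≡n (<⇒≤ lt)))) (lower-letter {w} lower k)
      , subst (λ y → h ≤ letter w y) (sym (+-assoc m k t))
          (≤-trans (≤-reflexive (sym (m≥n⇒m⊓n≡n (proj₁ (moved′ lt))))) (lower-letter {w} lower (k + t)))
      , ≤-trans (proj₁ (letter-pos⁻¹ u {k} (≤-<-trans z≤n lt))) (m≤n+m k m)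
      , ≤-trans (≤-reflexive (+-assoc m k t)) (≤-trans (+-monoʳ-≤ m k+t≤n) fits))
    where
    k = x ∸ m
    k+t≤n : k + t ≤ n
    k+t≤n = subst (k + t ≤_) same-length (proj₂ (letter-pos⁻¹ v (subst (0 <_) (sym (proj₂ (moved′ lt))) (≤-<-trans z≤n lt))))
    m+k≡x : m + k ≡ x
    m+k≡x = m+[n∸m]≡n {m} (<⇒≤ (m∸n≢0⇒n<m (m<n⇒n≢0 (proj₁ (letter-pos⁻¹ u {k} (≤-<-trans z≤n lt))))))

  reached-⊓ : ∀ w x → reached w x ≡ true → letter w x ⊓ h ≡ letter w (x + t) ⊓ h
  reached-⊓ w x eq = let h≤ , h≤′ , _ = reached-heights w x eq in trans (m≥n⇒m⊓n≡n h≤) (sym (m≥n⇒m⊓n≡n h≤′))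

  reached-δ : ∀ w x → reached w x ≡ true → δ 0 (letter w x) ≡ δ 0 (letter w (x + t))
  reached-δ w x eq = let _ , _ , 0<x , x+t≤w = reached-heights w x eq in
    trans (δ-pos (pos-at 0<x (≤-trans (m≤m+n x t) x+t≤w))) (sym (δ-pos (pos-at (≤-trans 0<x (m≤m+n x t)) x+t≤w)))
    where
    pos-at : ∀ {i} → 0 < i → i ≤ length w → 0 < letter w i
    pos-at 0<i i≤w = column-pos w (ℤ.+≤+ 0<i , ℤ.+≤+ i≤w)

  -- Both hypotheses hold between `w` and `up w` or `down w`. These words thus define the same
  -- permutation as `w`, which makes `up` and `down` mutually inverse.
  reached-cong : ∀ w w′ → length w ≡ length w′ → (∀ i → letter w i ⊓ h ≡ letter w′ i ⊓ h) → ∀ x → reached w x ≡ reached w′ x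
  reached-cong w w′ len eq x = does-⇔ (mk⇔ (transfer w w′ len eq) (transfer w′ w (sym len) (sym ∘ eq))) (reached? w x) (reached? w′ x)
    where
    transfer : ∀ w w′ → length w ≡ length w′ → (∀ i → letter w i ⊓ h ≡ letter w′ i ⊓ h) → Reached w x → Reached w′ x
    transfer w w′ len eq (m , m<w , (fits , le) , lt) =
      m , subst (λ L → m < suc L) len m<w ,
      (subst (m + n ≤_) len fits , λ k<n → ≤-trans (⊓-glb (le k<n) (m⊓n≤n _ h)) (≤-trans (≤-reflexive (eq _)) (m⊓n≤m _ h))) , lt

  π π⁻¹ : Word → ℕ → ℕ
  π   w = perm   (reached w) (length w)
  π⁻¹ w = perm⁻¹ (reached w) (length w)

  up down : Word → Word
  up   w = permuted (π w) w
  down w = permuted (π⁻¹ w) w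

  letter-up : ∀ w i → letter (up w) i ≡ letter w (π w i)
  letter-up w = letter-permuted (π w) w (perm-invariant (δ 0 ∘ letter w) (reached-δ w) (length w))

  letter-down : ∀ w i → letter (down w) i ≡ letter w (π⁻¹ w i)
  letter-down w = letter-permuted (π⁻¹ w) w (perm⁻¹-invariant (δ 0 ∘ letter w) (reached-δ w) (length w))

  up-⊓ : ∀ w i → letter (up w) i ⊓ h ≡ letter w i ⊓ h
  up-⊓ w i = trans (cong (_⊓ h) (letter-up w i)) (perm-invariant (λ i → letter w i ⊓ h) (reached-⊓ w) (length w) i)

  down-⊓ : ∀ w i → letter (down w) i ⊓ h ≡ letter w i ⊓ h
  down-⊓ w i = trans (cong (_⊓ h) (letter-down w i)) (perm⁻¹-invariant (λ i → letter w i ⊓ h) (reached-⊓ w) (length w) i)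

  length-up : ∀ w → length (up w) ≡ length w
  length-up w = length-word (length w) (letter w ∘ π w ∘ suc)

  length-down : ∀ w → length (down w) ≡ length w
  length-down w = length-word (length w) (letter w ∘ π⁻¹ w ∘ suc)

  up-down : ∀ w → up (down w) ≡ w
  up-down w = letter-ext _ w (trans (length-up (down w)) (length-down w)) λ i _ → begin
    letter (up (down w)) (suc i)           ≡⟨ letter-up (down w) (suc i) ⟩
    letter (down w) (π (down w) (suc i))   ≡⟨ letter-down w _ ⟩
    letter w (π⁻¹ w (π (down w) (suc i)))  ≡⟨ cong (letter w ∘ π⁻¹ w) (trans
                                                (cong (λ L → perm (reached (down w)) L (suc i)) (length-down w))
                                                (perm-cong (reached-cong (down w) w (length-down w) (down-⊓ w)) (length w) (suc i))) ⟩
    letter w (π⁻¹ w (π w (suc i)))         ≡⟨ cong (letter w) (perm-inverseʳ (reached w) (length w) (suc i)) ⟩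
    letter w (suc i)                       ∎
    where open ≡-Reasoning

  down-up : ∀ w → down (up w) ≡ w
  down-up w = letter-ext _ w (trans (length-down (up w)) (length-up w)) λ i _ → begin
    letter (down (up w)) (suc i)           ≡⟨ letter-down (up w) (suc i) ⟩
    letter (up w) (π⁻¹ (up w) (suc i))     ≡⟨ letter-up w _ ⟩
    letter w (π w (π⁻¹ (up w) (suc i)))    ≡⟨ cong (letter w ∘ π w) (trans
                                                (cong (λ L → perm⁻¹ (reached (up w)) L (suc i)) (length-up w))
                                                (perm⁻¹-cong (reached-cong (up w) w (length-up w) (up-⊓ w)) (length w) (suc i))) ⟩
    letter w (π w (π⁻¹ w (suc i)))         ≡⟨ cong (letter w) (perm-inverseˡ (reached w) (length w) (suc i)) ⟩
    letter w (suc i)                       ∎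
    where open ≡-Reasoning

  weight-up : ∀ w → weight (up w) ≡ weight w
  -- Index 0 joins the sum with letter 0, so that the sum runs over an initial segment, as `∑-perm`
  -- requires.
  weight-up w = begin
    weight (up w)                                ≡⟨ weight≡∑ (up w) ⟩
    ∑ (suc (length (up w))) (letter (up w))      ≡⟨ cong (λ L → ∑ (suc L) (letter (up w))) (length-up w) ⟩
    ∑ (suc (length w)) (letter (up w))           ≡⟨ ∑-cong (suc (length w)) (λ i _ → letter-up w i) ⟩
    ∑ (suc (length w)) (letter w ∘ π w)          ≡⟨ ∑-perm (suc (length w))
                                                    (λ x eq → s≤s (proj₂ (proj₂ (proj₂ (reached-heights w x eq)))))
                                                    (length w) (letter w) ⟩
    ∑ (suc (length w)) (letter w)                ≡⟨ weight≡∑ w ⟨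
    weight w                                     ∎
    where open ≡-Reasoning

  up-shift : ∀ w m k → LowerEmbeds w m → h < letter u k → letter (up w) (m + (k + t)) ≡ letter w (m + k)
  up-shift w m k lower@(fits , _) lt = begin
    letter (up w) (m + (k + t))  ≡⟨ letter-up w _ ⟩
    letter w (π w (m + (k + t))) ≡⟨ cong (letter w ∘ π w) (sym (+-assoc m k t)) ⟩
    letter w (π w (m + k + t))   ≡⟨ cong (letter w) (perm-shift (reached w) (length w) (m + k)
                                      (dec-true (reached? w (m + k)) is-reached)
                                      (≤-trans (proj₁ range) (m≤n+m k m)) (≤-trans (+-monoʳ-≤ m (proj₂ range)) fits)) ⟩
    letter w (m + k)             ∎
    where
    open ≡-Reasoning
    range : (0 < k) × (k ≤ n)
    range = letter-pos⁻¹ u (≤-<-trans z≤n lt)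
    is-reached : Reached w (m + k)
    is-reached = m , s≤s (≤-trans (m≤m+n m n) fits) , lower , subst (λ j → h < letter u j) (sym (m+n∸m≡n m k)) lt

  -- A covered column of `v` is a moved column of `u`, and `up` moves the letter below which it fits
  -- along with it. The other columns are at most `h`, and capped letters do not change.
  embeds-up : ∀ w {m} → Embeds u w m → Embeds v (up w) m
  embeds-up w {m} (fits , le) = subst₂ (λ a b → m + a ≤ b) (sym same-length) (sym (length-up w)) fits , le′
    where
    le′ : ∀ j → letter v j ≤ letter (up w) (m + j)
    le′ j with kept′ j
    ... | inj₁ (k , refl , lt) = ≤-trans (≤-reflexive (proj₂ (moved′ lt))) (≤-trans (le k)
            (≤-reflexive (sym (up-shift w m k (fits , λ {k} _ → ≤-trans (m⊓n≤m _ h) (le (suc k))) lt))))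
    ... | inj₂ eq = ≤-trans (≤-reflexive eq) (≤-trans (⊓-monoˡ-≤ h (le j)) (≤-trans (≤-reflexive (sym (up-⊓ w (m + j)))) (m⊓n≤m _ h)))

  -- Capping at `h` identifies `u` with `v` and `w` with `up w`, so the capped `u` embeds in `w` at
  -- `m`. This is what `up-shift` needs in order to trace the higher letters back.
  embeds-down : ∀ w {m} → Embeds v (up w) m → Embeds u w m
  embeds-down w {m} (fits , le) = fits′ , le′
    where
    fits′ : m + n ≤ length w
    fits′ = subst₂ (λ a b → m + a ≤ b) same-length (length-up w) fits
    lower : ∀ k → letter u k ⊓ h ≤ letter w (m + k)
    lower k = ≤-trans (≤-reflexive (sym (lifted-⊓ l (+ k)))) (≤-trans (⊓-monoˡ-≤ h (le k))
                (≤-trans (≤-reflexive (up-⊓ w (m + k))) (m⊓n≤m _ h)))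
    le′ : ∀ k → letter u k ≤ letter w (m + k)
    le′ k with h <? letter u k
    ... | no  h≮ = ≤-trans (≤-reflexive (sym (m≤n⇒m⊓n≡m (≮⇒≥ h≮)))) (lower k)
    ... | yes lt = ≤-trans (≤-reflexive (sym (proj₂ (moved′ lt)))) (≤-trans (le (k + t))
                     (≤-reflexive (up-shift w m k (fits′ , λ {k} _ → lower (suc k)) lt)))

  lifted⁺⇒∼ss : u ∼ss v
  lifted⁺⇒∼ss = mk∼ss u v up down up-down down-up length-up weight-up embeds-up embeds-down

-- A negative shift is the inverse of a positive one, and a shift by 0 changes nothing.
lifted⇒∼ss : ∀ {h t} → Lifted h t u v → u ∼ss v
lifted⇒∼ss {t = + suc d}    l = lifted⁺⇒∼ss l
lifted⇒∼ss {u} {v} {t = -[1+ d ]} l = ∼ss-sym {v} {u} (lifted⁺⇒∼ss (lifted-sym l))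
lifted⇒∼ss {u} {v} {h} {+ zero} l = subst (u ∼ss_) u≡v (∼ss-refl {u})
  where
  open Lifted l
  column-≡ : ∀ i → column u i ≡ column v i
  column-≡ i with h <? column u i
  ... | yes lt = sym (trans (cong (column v) (sym (ℤₚ.+-identityʳ i))) (proj₂ (moved i lt)))
  ... | no  h≮ = trans (sym (m≤n⇒m⊓n≡m (≮⇒≥ h≮))) (sym (kept i (subst (λ j → column u j ≤ h) (sym (ℤₚ.+-identityʳ i)) (≮⇒≥ h≮))))
  u≡v : u ≡ v
  u≡v = letter-ext u v (sym same-length) (λ i _ → column-≡ (+ suc i))

≈⇒∼ss : u ≈ v → u ∼ss v
≈⇒∼ss = go ∘ ≈⇒rigid*
  where
  go : Star RigidShift u v → u ∼ss v
  go {u}     ε                              = ∼ss-refl {u}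
  go {u} {v} (_◅_ {j = w} (_ , _ , r) rs) = ∼ss-trans {u} {w} {v} (lifted⇒∼ss (rigid⇒lifted r)) (go rs)

-- Clusters and least weights

m+k-m : ∀ m k → + (m + k) ℤ.- + m ≡ + k
m+k-m m k = trans (cong (ℤ._- + m) (ℤₚ.+-comm (+ m) (+ k))) (i+t-t (+ k) (+ m))

-- The pointwise maximum of the translates of `a` by the offsets `m < N` in `S`. Its level above `h`
-- is the sumset of these offsets and the level of `a` above `h`.
cluster : ℕ → (ℕ → Bool) → (ℤ → ℕ) → ℤ → ℕ
cluster zero    S a i = 0
cluster (suc N) S a i = cluster N S a i ⊔ (if S N then a (i ℤ.- + N) else 0)

module _ {S : ℕ → Bool} {a : ℤ → ℕ} {i : ℤ} {k : ℕ} where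
  cluster-> : ∀ {N m} → m < N → T (S m) → k < a (i ℤ.- + m) → k < cluster N S a i
  cluster-> {suc N} {m} m<1+N Sm lt with m≤n⇒m<n∨m≡n (s≤s⁻¹ m<1+N)
  ... | inj₁ m<N  = <-≤-trans (cluster-> m<N Sm lt) (m≤m⊔n _ _)
  ... | inj₂ refl with true ← S m = <-≤-trans lt (m≤n⊔m (cluster m S a i) _)

  cluster->⁻¹ : ∀ N → k < cluster N S a i → ∃ λ m → m < N × T (S m) × k < a (i ℤ.- + m)
  cluster->⁻¹ (suc N) lt with k <? cluster N S a i
  ... | yes lt′ with m , m<N , rest ← cluster->⁻¹ N lt′ = m , m<n⇒m<1+n m<N , rest
  cluster->⁻¹ (suc N) lt | no k≮ with S N in SN
  ... | true  = N , ≤-refl , subst T (sym SN) tt , (≰⇒> λ le → <⇒≱ lt (⊔-lub (≮⇒≥ k≮) le))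
  ... | false = contradiction (<-≤-trans lt (⊔-lub (≮⇒≥ k≮) z≤n)) (n≮n k)

cluster-supported : ∀ N S {a n} → SupportedIn n a → SupportedIn (N + n) (cluster N S a)
cluster-supported N S {a} {n} supp i lt with m , m<N , _ , lt′ ← cluster->⁻¹ N lt
  with k , k<n , eq ← in-window (supp _ lt′)
  = subst (_∈[1⋯ N + n ]) (trans (cong (ℤ._+ + m) (sym eq)) (i-t+t i (+ m)))
      (ℤ.+≤+ (s≤s z≤n) , ℤ.+≤+ (≤-trans (≤-reflexive (+-comm (suc k) m)) (+-mono-≤ (<⇒≤ m<N) k<n)))

module _ {h s} {a b : ℤ → ℕ} (a→b : ∀ i → h < a i → h < b (i ℤ.+ s)) where
  cluster-translate : ∀ N S i → h < cluster N S a i → h < cluster N S b (i ℤ.+ s)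
  cluster-translate N S i lt with m , m<N , Sm , lt′ ← cluster->⁻¹ N lt =
    cluster-> m<N Sm (subst (λ j → h < b j) (exchange i (ℤ.- + m) s) (a→b _ lt′))
    where
    exchange : ∀ i m s → i ℤ.+ m ℤ.+ s ≡ i ℤ.+ s ℤ.+ m
    exchange = ℤ-Solver.solve-∀

suc-pred-mono : ∀ {m n} → m ≤ n → 0 < n → suc (pred m) ≤ n
suc-pred-mono {zero}  _   0<n = 0<n
suc-pred-mono {suc m} m≤n _   = m≤n

-- The composite `suc ∘ pred` turns 0 into 1, the least letter, at positions that the cluster leaves
-- empty.
cost : ℕ → (ℕ → Bool) → Word → ℕ
cost N S u = ∑ᶻ (N + length u) (suc ∘ pred ∘ cluster N S (column u))

-- cost N S u is the least weight of a word of length N + length u in which u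
-- embeds at all offsets m < N with S m.
cost-≤ : ∀ N S → u ∼ss v → length u ≡ length v → cost N S v ≤ cost N S u
cost-≤ {u} {v} N S (f , spec) len = begin
  cost N S v                                    ≡⟨ cong (λ n → ∑ᶻ (N + n) (suc ∘ pred ∘ cluster N S (column v))) (sym len) ⟩
  ∑ L (λ i → suc (pred (cluster N S (column v) (+ suc i)))) ≤⟨ ∑-mono-≤ L (λ i i<L → suc-pred-mono (below i)
                                                              (letter-pos fw i (subst (i <_) (sym length-fw) i<L))) ⟩
  ∑ L (letter fw ∘ suc)                         ≡⟨ cong (λ n → ∑ n (letter fw ∘ suc)) length-fw ⟨
  ∑ (length fw) (letter fw ∘ suc)               ≡⟨ sum-map≡∑ id fw ⟨
  weight fw                                     ≡⟨ proj₁ (proj₂ (spec least)) ⟩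
  weight least                                  ≡⟨ weight-word L g ⟩
  cost N S u                                    ∎
  where
  open ≤-Reasoning
  L = N + length u
  g : ℕ → ℕ
  g i = cluster N S (column u) (+ suc i)
  least fw : Word
  least = word L g
  fw    = Bijection.to f least
  length-fw : length fw ≡ L
  length-fw = trans (proj₁ (spec least)) (length-word L g)
  least-embeds : ∀ {m} → m < N → T (S m) → Embeds u least m
  least-embeds {m} m<N Sm = subst (m + length u ≤_) (sym (length-word L g)) (+-monoˡ-≤ (length u) (<⇒≤ m<N)) , le
    where
    le : ∀ k → letter u k ≤ letter least (m + k)
    le zero    = ≤-trans (≤-reflexive (letter-0 u)) z≤n
    le (suc k) with k <? length u
    ... | no  k≮u = ≤-trans (≤-reflexive (letter-> u k (≮⇒≥ k≮u))) z≤n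
    ... | yes k<u rewrite +-suc m k | letter-word L g (m + k) (+-mono-< m<N k<u) =
      ≤-trans (≮⇒≥ (λ lt → n≮n _ (cluster-> {S} {column u} {+ suc (m + k)} m<N Sm
                (subst (λ i → g (m + k) < column u i) (sym (trans (cong (λ j → + j ℤ.- + m) (sym (+-suc m k))) (m+k-m m (suc k)))) lt))))
              (n≤suc-pred (g (m + k)))
      where
      n≤suc-pred : ∀ n → n ≤ suc (pred n)
      n≤suc-pred zero    = z≤n
      n≤suc-pred (suc n) = ≤-refl
  -- A column of the cluster comes from a copy of `v` at some offset in `S`. There `u` embeds in
  -- `least`, hence `v` embeds in `fw`.
  below : ∀ i → cluster N S (column v) (+ suc i) ≤ letter fw (suc i)
  below i = ≮⇒≥ not-above
    where
    not-above : ¬ (letter fw (suc i) < cluster N S (column v) (+ suc i))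
    not-above lt with m , m<N , Sm , lt′ ← cluster->⁻¹ N lt
      with k , _ , eq ← in-window (column-supported v (+ suc i ℤ.- + m) (≤-<-trans z≤n lt′))
      with embeds ← Em⇒Embeds v fw (proj₁ (proj₂ (proj₂ (spec least))) (Embeds⇒Em u least (least-embeds m<N Sm)))
      = <⇒≱ lt′ (≤-trans (≤-reflexive (cong (column v) eq)) (≤-trans (proj₂ embeds (suc k)) (≤-reflexive (cong (letter fw) m+k≡i))))
      where
      m+k≡i : m + suc k ≡ suc i
      m+k≡i = ℤₚ.+-injective (trans (ℤₚ.+-comm (+ m) (+ suc k)) (trans (cong (ℤ._+ + m) (sym eq)) (i-t+t (+ suc i) (+ m))))

cost-≡ : u ∼ss v → length u ≡ length v → ∀ N S → cost N S u ≡ cost N S v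
cost-≡ {u} {v} ss len N S = ≤-antisym (cost-≤ {v} {u} N S (∼ss-sym {u} {v} ss) (sym len)) (cost-≤ {u} {v} N S ss len)

-- Recovering levels from least weights

pred-split : ∀ m h → suc (pred m) ≡ suc (pred (m ⊓ suc h)) + (m ∸ suc h)
pred-split zero    h = refl
pred-split (suc m) h = cong suc (sym (trans (cong (λ x → x + (m ∸ h)) (⊓-comm m h)) (m⊓n+n∸m≡n h m)))

module _ {h s} (sizes : level-size h u ≡ level-size h v) (len : length u ≡ length v)
         (incl : ∀ i → h < column v i → h < column u (i ℤ.+ s)) where
  -- Two finite sets of the same size are equal once one contains the other; here one is a level of
  -- `u` and the other a translated level of `v`.
  inclusion⇒translated : Translated h (ℤ.- s) u v
  inclusion⇒translated i = tight , λ lt → subst (λ j → h < column u j) (i-t+t i s) (incl (i ℤ.- s) lt)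
    where
    n = length u
    g′ : ℤ → ℕ
    g′ i = δ h (column v (i ℤ.- s))
    g′-≤ : ∀ i → g′ i ≤ δ h (column u i)
    g′-≤ i = δ-mono {m = column v (i ℤ.- s)} (λ lt → subst (λ j → h < column u j) (i-t+t i s) (incl (i ℤ.- s) lt))
    g′-supp : SupportedIn n g′
    g′-supp i lt = column-supported u i (≤-<-trans z≤n (δ-pos⁻¹ (<-≤-trans lt (g′-≤ i))))
    sum-≤ : ∑ᶻ n (δ h ∘ column u) ≤ ∑ᶻ n g′
    sum-≤ = begin
      ∑ᶻ n (δ h ∘ column u)            ≡⟨ level-size≡∑ᶻ h u ⟨
      level-size h u                   ≡⟨ sizes ⟩
      level-size h v                   ≡⟨ level-size≡∑ᶻ h v ⟩
      ∑ᶻ (length v) (δ h ∘ column v)   ≡⟨ cong (λ n → ∑ᶻ n (δ h ∘ column v)) (sym len) ⟩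
      ∑ᶻ n (δ h ∘ column v)            ≡⟨ ∑-cong n (λ i _ → cong (δ h ∘ column v) (sym (i+t-t (+ suc i) s))) ⟩
      ∑ᶻ n (λ i → g′ (i ℤ.+ s))        ≤⟨ ∑ᶻ-shift-≤ n g′-supp s ⟩
      ∑ᶻ n g′                          ∎
      where open ≤-Reasoning
    tight : h < column u i → h < column v (i ℤ.- s)
    tight lt with k , k<n , refl ← in-window (column-supported u i (≤-<-trans z≤n lt)) =
      δ-pos⁻¹ (<-≤-trans (≤-reflexive (sym (δ-pos lt))) (∑-tight n (λ i → g′-≤ (+ suc i)) sum-≤ k k<n))

all : ℕ → Bool
all = const true

-- With `P_k` the level above `k`, each side is the sum of the sizes of the sumsets `P_k + S` over
-- all `k` from `h` upwards.
CostAbove : ℕ → Word → Word → Set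
CostAbove h u v = ∀ N S → ∑ᶻ (N + length u) (λ i → cluster N S (column u) i ∸ h) ≡
                              ∑ᶻ (N + length u) (λ i → cluster N S (column v) i ∸ h)

-- Let P be the level of u above h.  Compare the clusters for all offsets
-- m < 3n with those for the offsets m such that 2n - m lies outside P.  At the
-- column 2n the cluster of u falls below level h when passing from the former
-- to the latter.  The costs below h agree, so at some column j the cluster of v
-- loses a level x ≤ h as well, which means that all columns of v of height
-- above x, hence all of its columns of height above h, lie in P + (j - 2n).
module _ {h} (0<h : 0 < h) (ss : u ∼ss v) (len : length u ≡ length v)
         (above : CostAbove (suc h) u v) where
  private
    n = length u
    N = n + n + n
    L = N + n
    S : ℕ → Bool
    S m = column u (+ (n + n) ℤ.- + m) ≤ᵇ h
    -- The part of the cost up to height `suc h`; by `pred-split` the rest is the sum compared in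
    -- `CostAbove (suc h)`.
    capped : (ℕ → Bool) → Word → ℤ → ℕ
    capped R x i = suc (pred (cluster N R (column x) i ⊓ suc h))

    capped-≡ : ∀ R → ∑ᶻ L (capped R u) ≡ ∑ᶻ L (capped R v)
    capped-≡ R = +-cancelʳ-≡ (∑ᶻ L (λ i → cluster N R (column u) i ∸ suc h)) _ _ (begin
      ∑ᶻ L (capped R u) + ∑ᶻ L (λ i → cluster N R (column u) i ∸ suc h) ≡⟨ split u ⟩
      ∑ᶻ L (suc ∘ pred ∘ cluster N R (column u))                        ≡⟨ cost-≡ {u} {v} ss len N R ⟩
      cost N R v                                                        ≡⟨ cong (λ n → ∑ᶻ (N + n) (suc ∘ pred ∘ cluster N R (column v))) (sym len) ⟩
      ∑ᶻ L (suc ∘ pred ∘ cluster N R (column v))                        ≡⟨ split v ⟨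
      ∑ᶻ L (capped R v) + ∑ᶻ L (λ i → cluster N R (column v) i ∸ suc h) ≡⟨ cong (_+_ (∑ᶻ L (capped R v))) (above N R) ⟨
      ∑ᶻ L (capped R v) + ∑ᶻ L (λ i → cluster N R (column u) i ∸ suc h) ∎)
      where
      open ≡-Reasoning
      split : ∀ x → ∑ᶻ L (capped R x) + ∑ᶻ L (λ i → cluster N R (column x) i ∸ suc h) ≡ ∑ᶻ L (suc ∘ pred ∘ cluster N R (column x))
      split x = trans (sym (∑-distrib-+ L _ _)) (∑-cong L (λ i _ → sym (pred-split (cluster N R (column x) (+ suc i)) h)))

    cluster-all : ∀ x i → cluster N S (column x) i ≤ cluster N all (column x) i
    cluster-all x i = ≮⇒≥ λ lt → let m , m<N , _ , lt′ = cluster->⁻¹ N lt in n≮n _ (cluster-> {all} {column x} {i} m<N tt lt′)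

    u-drops : ∀ {k} → k < n → h < letter u (suc k) → ∑ᶻ L (capped S u) < ∑ᶻ L (capped all u)
    u-drops {k} k<n lt = ∑-mono-< L (λ i → s≤s (pred-mono-≤ (⊓-monoˡ-≤ (suc h) (cluster-all u (+ suc i)))))
      -- Since `∑ᶻ` numbers columns from 1, column `2n` has index `pred (n + n)`.
      {pred (n + n)} idx<L (subst (λ i → capped S u i < capped all u i) (cong +_ (sym idx)) (s≤s drop))
      where
      0<n+n : 0 < n + n
      0<n+n = ≤-trans (≤-<-trans z≤n k<n) (m≤m+n n n)
      idx : suc (pred (n + n)) ≡ n + n
      idx = suc-pred (n + n) {{>-nonZero 0<n+n}}
      idx<L : pred (n + n) < L
      idx<L = ≤-trans (≤-reflexive idx) (≤-trans (m≤m+n (n + n) n) (m≤m+n N n))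
      c = + (n + n)
      -- The offset `2n - (k + 1)` puts column `k + 1` of `u` onto column `2n`.
      high : suc h ≤ cluster N all (column u) c
      high = cluster-> {all} {column u} {c} {m = n + n ∸ suc k} (≤-<-trans (m∸n≤m (n + n) (suc k)) (m<m+n (n + n) (≤-<-trans z≤n k<n))) tt
        (subst (λ i → h < column u i) (sym (trans
          (cong (λ j → + j ℤ.- + (n + n ∸ suc k)) (sym (m∸n+n≡m (≤-trans k<n (m≤m+n n n))))) (m+k-m (n + n ∸ suc k) (suc k)))) lt)
      low : cluster N S (column u) c ≤ h
      low = ≮⇒≥ λ lt → let m , _ , Sm , lt′ = cluster->⁻¹ N lt in <⇒≱ lt′ (≤ᵇ⇒≤ _ _ Sm)
      -- The values are at most `pred h` and exactly `h`. They differ because `0 < h`; the heights 0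
      -- and 1 would cost the same.
      drop : pred (cluster N S (column u) c ⊓ suc h) < pred (cluster N all (column u) c ⊓ suc h)
      drop rewrite m≥n⇒m⊓n≡n high = ≤-<-trans (pred-mono-≤ (≤-trans (m⊓n≤m _ (suc h)) low)) (≤-reflexive (suc-pred h {{>-nonZero 0<h}}))

    v-drops : ∀ j → capped S v j < capped all v j →
              (cluster N S (column v) j ≤ h) × (cluster N S (column v) j < cluster N all (column v) j)
    v-drops j lt = s≤s⁻¹ (<-≤-trans x<l (m⊓n≤n y (suc h))) , <-≤-trans x<l (m⊓n≤m y (suc h))
      where
      x = cluster N S (column v) j
      y = cluster N all (column v) j
      x<l : x < y ⊓ suc h
      x<l = ≰⇒> λ l≤x → <⇒≱ lt (s≤s (pred-mono-≤ (⊓-glb l≤x (m⊓n≤n y (suc h)))))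

    v-supported : SupportedIn n (column v)
    v-supported = subst (λ n → SupportedIn n (column v)) (sym len) (column-supported v)

    inclusion : ∀ j → (cluster N S (column v) j ≤ h) × (cluster N S (column v) j < cluster N all (column v) j) →
                ∀ i → h < column v i → h < column u (i ℤ.+ (+ (n + n) ℤ.- j))
    inclusion j (x≤h , x<y) i lt
      with m , m<N , _ , lt₀ ← cluster->⁻¹ N x<y
      with p , p<n , eq₀ ← in-window (v-supported (j ℤ.- + m) (≤-<-trans z≤n lt₀))
      with q , q<n , refl ← in-window (v-supported i (≤-<-trans z≤n lt))
      = subst (λ z → h < column u z) (trans (cong (λ z → + (n + n) ℤ.- z) m′≡) (regroup (+ (n + n)) j (+ suc q)))
          (in-P m′ m′<N (subst (λ z → x < column v z) (sym (trans (cong (λ z → j ℤ.- z) m′≡) (j-[j-i] j (+ suc q)))) (≤-<-trans x≤h lt)))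
      where
      x = cluster N S (column v) j
      -- If such an offset belonged to `S`, the cluster of `v` at `j` would exceed its own value
      -- `x`.
      in-P : ∀ m → m < N → x < column v (j ℤ.- + m) → h < column u (+ (n + n) ℤ.- + m)
      in-P m m<N lt = ≰⇒> λ le → n≮n x (cluster-> {S} {column v} {j} m<N (≤⇒≤ᵇ le) lt)
      regroup : ∀ c j i → c ℤ.- (j ℤ.- i) ≡ i ℤ.+ (c ℤ.- j)
      regroup = ℤ-Solver.solve-∀
      j-[j-i] : ∀ j i → j ℤ.- (j ℤ.- i) ≡ i
      j-[j-i] = ℤ-Solver.solve-∀
      -- The witness satisfies `2n - m` in `P`, which lies within 1 to `n`. This leaves room to
      -- replace `m` by the offset `m′ = j - i` for any column `i` of `v`, with `m′` still between 0
      -- and `3n - 1`.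
      m-range : (n ≤ m) × (m < n + n)
      m-range with r , r<n , eq ← in-window (column-supported u (+ (n + n) ℤ.- + m) (≤-<-trans z≤n (in-P m m<N lt₀)))
        with m+r ← ℤₚ.+-injective (trans (sym (i-t+t (+ (n + n)) (+ m))) (cong (ℤ._+ + m) eq))
        = +-cancelˡ-≤ n n m (≤-trans (≤-reflexive m+r) (+-monoˡ-≤ m r<n)) , ≤-trans (s≤s (m≤n+m m r)) (≤-reflexive (sym m+r))
      m′ = suc p + m ∸ suc q
      q≤ : suc q ≤ suc p + m
      q≤ = ≤-trans q<n (≤-trans (proj₁ m-range) (m≤n+m m (suc p)))
      m′<N : m′ < N
      m′<N = ≤-<-trans (m∸n≤m (p + m) q) (≤-trans (+-mono-<-≤ p<n (<⇒≤ (proj₂ m-range))) (≤-reflexive (+-comm n (n + n))))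
      m′≡ : + m′ ≡ j ℤ.- + suc q
      m′≡ = begin
        + (suc p + m ∸ suc q)        ≡⟨ ℤₚ.⊖-≥ q≤ ⟨
        (suc p + m) ℤ.⊖ suc q        ≡⟨ ℤₚ.m-n≡m⊖n (suc p + m) (suc q) ⟨
        + (suc p + m) ℤ.- + suc q    ≡⟨ cong (λ z → z ℤ.+ + m ℤ.- + suc q) eq₀ ⟨
        j ℤ.- + m ℤ.+ + m ℤ.- + suc q ≡⟨ cong (ℤ._- + suc q) (i-t+t j (+ m)) ⟩
        j ℤ.- + suc q                ∎
        where open ≡-Reasoning

  cost⇒translated : level-size h u ≡ level-size h v → ∃ λ t → Translated h t u v
  cost⇒translated sizes = cases (anyUpTo? (λ k → h <? letter u (suc k)) n)
    where
    cases : Dec (∃ λ k → k < n × h < letter u (suc k)) → ∃ λ t → Translated h t u v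
    -- An empty level of `u` is included in that of `v`, and equality of the sizes does the rest.
    cases (no none) = _ , Translated-sym {v} {u} (inclusion⇒translated {v} {u} {s = 0ℤ} (sym sizes) (sym len) empty)
      where
      empty : ∀ i → h < column u i → h < column v (i ℤ.+ 0ℤ)
      empty i lt with k , k<n , refl ← in-window (column-supported u i (≤-<-trans z≤n lt)) = contradiction (k , k<n , lt) none
    cases (yes (k , k<n , lt)) =
      -- The capped sums of `u` and `v` agree, so the drop for `u` shows up in some column of `v`.
      let j , _ , drop = ∑-reflects-< L (subst₂ _<_ (capped-≡ S) (capped-≡ all) (u-drops k<n lt))
      in _ , inclusion⇒translated {u} {v} sizes len (inclusion (+ suc j) (v-drops (+ suc j) drop))

↭⇒level-size : map value u ↭ map value v → ∀ k → level-size k u ≡ level-size k v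
↭⇒level-size p k = sum-↭ (map⁺ (δ k) p)

∼ss⇒≈ : map value u ↭ map value v → u ∼ss v → u ≈ v
∼ss⇒≈ {u} {v} p ss = record { length-≡ = len ; levels = levels′ }
  where
  n = length u
  len : length u ≡ length v
  len = trans (sym (length-map value u)) (trans (↭-length p) (length-map value v))
  B = weight u ⊔ weight v

  -- Descends in `h`, with `k` bounding the distance to `B`, above which no columns rise. Equality
  -- above `suc h` makes the levels at `h` translates, so the clusters have equally many columns
  -- above `h`, and equality extends down to `h`.
  cost-above : ∀ k h → 0 < h → B ≤ k + h → CostAbove h u v
  cost-above zero h _ B≤h N S = ∑-cong (N + n) λ i _ → trans (vanish u (m≤m⊔n _ _) (+ suc i)) (sym (vanish v (m≤n⊔m _ _) (+ suc i)))
    where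
    vanish : ∀ x → weight x ≤ B → ∀ i → cluster N S (column x) i ∸ h ≡ 0
    vanish x x≤B i = m≤n⇒m∸n≡0 (≮⇒≥ λ lt → let m , _ , _ , lt′ = cluster->⁻¹ N lt in
      <⇒≱ lt′ (≤-trans (column-≤-weight x (i ℤ.- + m)) (≤-trans x≤B B≤h)))
  cost-above (suc k) h 0<h B≤ N S = begin
    ∑ᶻ (N + n) (λ i → M u i ∸ h)                                        ≡⟨ split u ⟩
    ∑ᶻ (N + n) (λ i → M u i ∸ suc h) + ∑ᶻ (N + n) (δ h ∘ M u)           ≡⟨ cong₂ _+_ (above N S) (∑δ-translate (N + n) h
                                                                            (cluster-supported N S (column-supported u))
                                                                            (cluster-supported N S (subst (λ n → SupportedIn n (column v)) (sym len) (column-supported v)))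
                                                                            t M-translated) ⟩
    ∑ᶻ (N + n) (λ i → M v i ∸ suc h) + ∑ᶻ (N + n) (δ h ∘ M v)           ≡⟨ split v ⟨
    ∑ᶻ (N + n) (λ i → M v i ∸ h)                                        ∎
    where
    open ≡-Reasoning
    M : Word → ℤ → ℕ
    M x = cluster N S (column x)
    split : ∀ x → ∑ᶻ (N + n) (λ i → M x i ∸ h) ≡ ∑ᶻ (N + n) (λ i → M x i ∸ suc h) + ∑ᶻ (N + n) (δ h ∘ M x)
    split x = trans (∑-cong (N + n) (λ i _ → ∸-δ h (M x (+ suc i)))) (∑-distrib-+ (N + n) _ _)
    above : CostAbove (suc h) u v
    above = cost-above k (suc h) z<s (≤-trans B≤ (≤-reflexive (sym (+-suc k h))))
    translated : ∃ λ t → Translated h t u v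
    translated = cost⇒translated {u} {v} 0<h ss len above (↭⇒level-size {u} {v} p h)
    t = proj₁ translated
    tr = proj₂ translated
    M-translated : ∀ i → (h < M u i → h < M v (i ℤ.+ t)) × (h < M v (i ℤ.+ t) → h < M u i)
    M-translated i = cluster-translate {a = column u} {b = column v} (λ i → proj₁ (tr i)) N S i ,
      λ lt → subst (λ j → h < M u j) (i+t-t i t)
        (cluster-translate {a = column v} {b = column u} (λ i → proj₁ (Translated-sym {u} {v} tr i)) N S (i ℤ.+ t) lt)

  levels′ : ∀ h → ∃ λ t → Translated h t u v
  -- Level 0 is the set of all positions and is settled by the lengths, as `cost⇒translated` assumes
  -- `0 < h`.
  levels′ zero    = 0ℤ , λ i → subst (λ j → (0 < column u i → 0 < column v j) × (0 < column v j → 0 < column u i)) (sym (ℤₚ.+-identityʳ i))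
    ((λ lt → column-pos v (subst (i ∈[1⋯_]) len (column-supported u i lt))) ,
     (λ lt → column-pos u (subst (i ∈[1⋯_]) (sym len) (column-supported v i lt))))
  levels′ (suc h) = cost⇒translated {u} {v} z<s ss len (cost-above B (suc (suc h)) z<s (m≤m+n B _)) (↭⇒level-size {u} {v} p (suc h))

-- Reversal and symmetric levels

column-reverse : ∀ u i → column (reverse u) i ≡ column u (+ suc (length u) ℤ.- i)
column-reverse u i with i ∈?[1⋯ length u ]
... | yes i∈ with k , k<u , refl ← in-window i∈ = trans (letter-reverse u k j k+j) (sym (cong (column u) (begin
  + suc (length u) ℤ.- + suc k  ≡⟨ cong (λ n → + suc n ℤ.- + suc k) k+j ⟨
  + suc (suc k + j) ℤ.- + suc k ≡⟨ cong (λ n → + n ℤ.- + suc k) (+-suc (suc k) j) ⟨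
  + (suc k + suc j) ℤ.- + suc k ≡⟨ m+k-m (suc k) (suc j) ⟩
  + suc j                       ∎)))
  where
  open ≡-Reasoning
  j = length u ∸ suc k
  k+j : suc (k + j) ≡ length u
  k+j = m+[n∸m]≡n k<u
column-reverse u i | no i∉ = trans (column-outside (reverse u) (i∉ ∘ subst (i ∈[1⋯_]) (length-reverse u))) (sym (vanishes supp i∉))
  where
  supp : SupportedIn (length u) (λ i → column u (+ suc (length u) ℤ.- i))
  supp i lt with k , k<u , eq ← in-window (column-supported u (+ suc (length u) ℤ.- i) lt) =
    subst (_∈[1⋯ length u ]) (trans (cong (λ j → + suc (length u) ℤ.- j) (sym eq)) (reflect (+ suc (length u)) i))
      (subst (_∈[1⋯ length u ]) (sym (trans (ℤₚ.m-n≡m⊖n (suc (length u)) (suc k)) (ℤₚ.⊖-≥ (m≤n⇒m≤1+n k<u))))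
        (ℤ.+≤+ (m<n⇒0<n∸m k<u) , ℤ.+≤+ (m∸n≤m (length u) k)))
    where
    reflect : ∀ c i → c ℤ.- (c ℤ.- i) ≡ i
    reflect = ℤ-Solver.solve-∀

≈-reverse : u ≈ v → reverse u ≈ reverse v
≈-reverse {u} {v} u≈v = record
  { length-≡ = trans (length-reverse u) (trans (_≈_.length-≡ u≈v) (sym (length-reverse v)))
  ; levels   = λ h → ℤ.- proj₁ (_≈_.levels u≈v h) , reversed h
  }
  where
  regroup : ∀ n i t → n ℤ.- (i ℤ.+ (ℤ.- t)) ≡ n ℤ.- i ℤ.+ t
  regroup = ℤ-Solver.solve-∀
  reversed : ∀ h → Translated h (ℤ.- proj₁ (_≈_.levels u≈v h)) (reverse u) (reverse v)
  reversed h i with t , tr ← _≈_.levels u≈v h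
    rewrite column-reverse u i | column-reverse v (i ℤ.+ (ℤ.- t)) | sym (_≈_.length-≡ u≈v) | regroup (+ suc (length u)) i t
    = tr (+ suc (length u) ℤ.- i)

-- The number `c` is twice the centre of the level, which allows a centre halfway between two
-- columns; it may vary with `h`.
Symmetric : Word → Set
Symmetric u = ∀ h → ∃ λ c → ∀ i → h < column u i → h < column u (c ℤ.- i)

symmetric⇒≈reverse : Symmetric u → u ≈ reverse u
symmetric⇒≈reverse {u} sy = record { length-≡ = sym (length-reverse u) ; levels = levels′ }
  where
  n = + suc (length u)
  reflect : ∀ n c i → n ℤ.- (i ℤ.+ (n ℤ.- c)) ≡ c ℤ.- i
  reflect = ℤ-Solver.solve-∀
  involutive : ∀ c i → c ℤ.- (c ℤ.- i) ≡ i
  involutive = ℤ-Solver.solve-∀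
  levels′ : ∀ h → ∃ λ t → Translated h t u (reverse u)
  levels′ h with c , s ← sy h = n ℤ.- c , translated
    where
    translated : Translated h (n ℤ.- c) u (reverse u)
    translated i rewrite column-reverse u (i ℤ.+ (n ℤ.- c)) | reflect n c i =
      s i , λ lt → subst (λ j → h < column u j) (involutive c i) (s (c ℤ.- i) lt)

≈reverse⇒symmetric : u ≈ reverse u → Symmetric u
≈reverse⇒symmetric {u} u≈ h with t , tr ← _≈_.levels u≈ h = n ℤ.- t , λ i lt →
  subst (λ j → h < column u j) (regroup n i t) (subst (h <_) (column-reverse u (i ℤ.+ t)) (proj₁ (tr i) lt))
  where
  n = + suc (length u)
  regroup : ∀ n i t → n ℤ.- (i ℤ.+ t) ≡ n ℤ.- t ℤ.- i
  regroup = ℤ-Solver.solve-∀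

-- Shapes of levels up to translation

Translate : (ℤ → Set) → (ℤ → Set) → Set
Translate P Q = ∃ λ t → ∀ i → (P i → Q (i ℤ.+ t)) × (Q (i ℤ.+ t) → P i)

Above : ℕ → Word → ℤ → Set
Above h u i = h < column u i

HasShape : (ℕ → ℤ → Set) → Word → Set
HasShape Q u = ∀ h → Translate (Above h u) (Q h)

same-shape⇒≈ : ∀ {Q} → HasShape Q u → HasShape Q v → length u ≡ length v → u ≈ v
same-shape⇒≈ {u} {v} {Q} su sv len = record { length-≡ = len ; levels = levels′ }
  where
  regroup : ∀ i s t → i ℤ.+ (s ℤ.- t) ℤ.+ t ≡ i ℤ.+ s
  regroup = ℤ-Solver.solve-∀
  levels′ : ∀ h → ∃ λ t → Translated h t u v
  levels′ h with s , eu ← su h | t , ev ← sv h = s ℤ.- t , λ i →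
    (λ lt → proj₂ (ev (i ℤ.+ (s ℤ.- t))) (subst (Q h) (sym (regroup i s t)) (proj₁ (eu i) lt))) ,
    (λ lt → proj₂ (eu i) (subst (Q h) (regroup i s t) (proj₁ (ev (i ℤ.+ (s ℤ.- t))) lt)))

shape⇒symmetric : ∀ {Q} → HasShape Q u → (∀ h → ∃ λ c → ∀ j → Q h j → Q h (c ℤ.- j)) → Symmetric u
shape⇒symmetric {u} {Q} su sQ h with t , e ← su h | c , s ← sQ h = c ℤ.- t ℤ.- t , λ i lt →
  proj₂ (e (c ℤ.- t ℤ.- t ℤ.- i)) (subst (Q h) (regroup c t i) (s (i ℤ.+ t) (proj₁ (e i) lt)))
  where
  regroup : ∀ c t i → c ℤ.- (i ℤ.+ t) ≡ c ℤ.- t ℤ.- t ℤ.- i ℤ.+ t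
  regroup = ℤ-Solver.solve-∀

-- Integer inequalities by exhibiting differences

module _ {a b p q : ℤ} where
  ≤-by₁ : a ℤ.≤ b → b ℤ.- a ≡ q ℤ.- p → p ℤ.≤ q
  ≤-by₁ a≤b eq = ℤₚ.0≤i-j⇒j≤i (subst (0ℤ ℤ.≤_) eq (ℤₚ.i≤j⇒0≤j-i a≤b))

  ≤-by₂ : ∀ {c d} → a ℤ.≤ b → c ℤ.≤ d → b ℤ.- a ℤ.+ (d ℤ.- c) ≡ q ℤ.- p → p ℤ.≤ q
  ≤-by₂ a≤b c≤d eq = ℤₚ.0≤i-j⇒j≤i (subst (0ℤ ℤ.≤_) eq (ℤₚ.+-mono-≤ (ℤₚ.i≤j⇒0≤j-i a≤b) (ℤₚ.i≤j⇒0≤j-i c≤d)))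

+1≰ : ∀ i → ¬ (1ℤ ℤ.+ i ℤ.≤ i)
+1≰ i le = ℤₚ.<-irrefl refl (ℤₚ.suc[i]≤j⇒i<j le)

≤∧≢⇒+1≤ : ∀ {i j} → i ℤ.≤ j → i ≢ j → 1ℤ ℤ.+ i ℤ.≤ j
≤∧≢⇒+1≤ i≤j i≢j = ℤₚ.i<j⇒suc[i]≤j (ℤₚ.≤∧≢⇒< i≤j i≢j)

double-injective : ∀ {i j} → i ℤ.+ i ≡ j ℤ.+ j → i ≡ j
double-injective {i} {j} eq with ℤₚ.<-cmp i j
... | tri< i<j _ _ = contradiction eq (ℤₚ.<⇒≢ (ℤₚ.+-mono-< i<j i<j))
... | tri≈ _ i≡j _ = i≡j
... | tri> _ _ j<i = contradiction (sym eq) (ℤₚ.<⇒≢ (ℤₚ.+-mono-< j<i j<i))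

-- Reflections of punctured intervals

Between : ℤ → ℤ → ℤ → Set
Between α β j = (α ℤ.≤ j) × (j ℤ.≤ β)

between-reflect : ∀ α β j → Between α β j → Between α β (α ℤ.+ β ℤ.- j)
between-reflect α β j (α≤j , j≤β) = ≤-by₁ j≤β (ℤ-Solver.solve (α ∷ β ∷ j ∷ [])) , ≤-by₁ α≤j (ℤ-Solver.solve (α ∷ β ∷ j ∷ []))

module _ {α β y : ℤ} (y∈ : Between α β y) (y≢α : y ≢ α) (y≢β : y ≢ β) where
  -- The reflection must swap the end points.
  punctured-centre : ∀ c → (∀ j → Between α β j → j ≢ y → Between α β (c ℤ.- j) × (c ℤ.- j ≢ y)) → y ℤ.+ y ≡ α ℤ.+ β
  punctured-centre c s with y ℤ.+ y ℤₚ.≟ α ℤ.+ β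
  ... | yes eq = eq
  -- Were `y` not the midpoint, its mirror image would be a remaining point that is reflected onto
  -- `y`.
  ... | no  neq = contradiction (reflect c y)
    (proj₂ (s (c ℤ.- y) (subst (λ c → Between α β (c ℤ.- y)) (sym c≡) (between-reflect α β y y∈)) c-y≢y))
    where
    reflect : ∀ c i → c ℤ.- (c ℤ.- i) ≡ i
    reflect = ℤ-Solver.solve-∀
    α≤β : α ℤ.≤ β
    α≤β = ℤₚ.≤-trans (proj₁ y∈) (proj₂ y∈)
    upper : c ℤ.- α ℤ.≤ β
    upper = proj₂ (proj₁ (s α (ℤₚ.≤-refl , α≤β) (y≢α ∘ sym)))
    lower : α ℤ.≤ c ℤ.- β
    lower = proj₁ (proj₁ (s β (α≤β , ℤₚ.≤-refl) (y≢β ∘ sym)))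
    c≡ : c ≡ α ℤ.+ β
    c≡ = ℤₚ.≤-antisym (≤-by₁ upper (ℤ-Solver.solve (α ∷ β ∷ c ∷ []))) (≤-by₁ lower (ℤ-Solver.solve (α ∷ β ∷ c ∷ [])))
    c-y≢y : c ℤ.- y ≢ y
    c-y≢y eq = neq (trans (cong (ℤ._+ y) (sym eq)) (trans (i-t+t c y) c≡))

-- Once the midpoint y is missing, removing z as well destroys the symmetry:
-- y is the image of y ± 1 if z is an end point, and of z otherwise.
twice-punctured : ∀ {α β y z} → 1ℤ ℤ.+ (1ℤ ℤ.+ α) ℤ.≤ y → β ≡ y ℤ.+ y ℤ.- α → Between α β z → z ≢ y → ∀ c →
  ¬ (∀ j → Between α β j → j ≢ y → j ≢ z → Between α β (c ℤ.- j) × (c ℤ.- j ≢ y) × (c ℤ.- j ≢ z))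
twice-punctured {α} {y = y} {z} 2+α≤y refl z∈ z≢y c s = cases (z ℤₚ.≟ α) (z ℤₚ.≟ (y ℤ.+ y ℤ.- α))
  where
  2+y≤β : 1ℤ ℤ.+ (1ℤ ℤ.+ y) ℤ.≤ (y ℤ.+ y ℤ.- α)
  2+y≤β = ≤-by₁ 2+α≤y (ℤ-Solver.solve (α ∷ y ∷ []))
  1+α≤y : 1ℤ ℤ.+ α ℤ.≤ y
  1+α≤y = ℤₚ.≤-trans (ℤₚ.i≤suc[i] _) 2+α≤y
  1+y≤β : 1ℤ ℤ.+ y ℤ.≤ (y ℤ.+ y ℤ.- α)
  1+y≤β = ℤₚ.≤-trans (ℤₚ.i≤suc[i] _) 2+y≤β
  α≤y : α ℤ.≤ y
  α≤y = ℤₚ.≤-trans (ℤₚ.i≤suc[i] _) 1+α≤y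
  y≤β : y ℤ.≤ (y ℤ.+ y ℤ.- α)
  y≤β = ℤₚ.≤-trans (ℤₚ.i≤suc[i] _) 1+y≤β
  α≤β : α ℤ.≤ (y ℤ.+ y ℤ.- α)
  α≤β = ℤₚ.≤-trans α≤y y≤β
  α≢y : α ≢ y
  α≢y refl = +1≰ _ 1+α≤y
  β≢y : (y ℤ.+ y ℤ.- α) ≢ y
  β≢y eq = +1≰ y (subst (1ℤ ℤ.+ y ℤ.≤_) eq 1+y≤β)
  1+α≢y : 1ℤ ℤ.+ α ≢ y
  1+α≢y refl = +1≰ _ 2+α≤y
  cases : Dec (z ≡ α) → Dec (z ≡ (y ℤ.+ y ℤ.- α)) → Empty.⊥
  -- The remaining end points are `1 + α` and `β`, which forces `c = 1 + 2y`; so `1 + y` is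
  -- reflected onto the missing `y`.
  cases (yes refl) _ = proj₁ (proj₂ (s (1ℤ ℤ.+ y)
    (ℤₚ.≤-trans α≤y (ℤₚ.i≤suc[i] y) , 1+y≤β)
    (λ eq → +1≰ y (ℤₚ.≤-reflexive eq)) (λ eq → +1≰ y (ℤₚ.≤-trans (ℤₚ.≤-reflexive eq) α≤y))))
                           (trans (cong (ℤ._- (1ℤ ℤ.+ y)) c≡) (ℤ-Solver.solve (α ∷ y ∷ [])))
    where
    upper : c ℤ.- (1ℤ ℤ.+ α) ℤ.≤ (y ℤ.+ y ℤ.- α)
    upper = proj₂ (proj₁ (s (1ℤ ℤ.+ α) (ℤₚ.i≤suc[i] α , ℤₚ.≤-trans 1+α≤y y≤β) 1+α≢y (λ eq → +1≰ α (ℤₚ.≤-reflexive eq))))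
    lower : 1ℤ ℤ.+ α ℤ.≤ c ℤ.- (y ℤ.+ y ℤ.- α)
    lower with b , _ , ≢α ← s (y ℤ.+ y ℤ.- α) (α≤β , ℤₚ.≤-refl) β≢y (λ eq → α≢y (ℤₚ.≤-antisym α≤y (subst (y ℤ.≤_) eq y≤β))) =
      ≤∧≢⇒+1≤ (proj₁ b) (≢α ∘ sym)
    c≡ : c ≡ 1ℤ ℤ.+ (y ℤ.+ y)
    c≡ = ℤₚ.≤-antisym (≤-by₁ upper (ℤ-Solver.solve (α ∷ y ∷ c ∷ []))) (≤-by₁ lower (ℤ-Solver.solve (α ∷ y ∷ c ∷ [])))
  -- The remaining end points are `α` and `β - 1`, which forces `c = 2y - 1`; so `y - 1` is
  -- reflected onto the missing `y`.
  cases (no z≢α) (yes refl) = proj₁ (proj₂ (s (y ℤ.- 1ℤ) (≤-by₁ 1+α≤y (ℤ-Solver.solve (α ∷ y ∷ [])) , y-1≤β) y-1≢y y-1≢β))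
                                (trans (cong (ℤ._- (y ℤ.- 1ℤ)) c≡) (ℤ-Solver.solve (α ∷ y ∷ [])))
    where
    y-1≤β : y ℤ.- 1ℤ ℤ.≤ y ℤ.+ y ℤ.- α
    y-1≤β = ℤₚ.≤-trans (ℤₚ.i-j≤i y 1ℤ) y≤β
    y-1≢y : y ℤ.- 1ℤ ≢ y
    y-1≢y eq = +1≰ y (ℤₚ.≤-reflexive (trans (cong (λ i → 1ℤ ℤ.+ i) (sym eq)) (ℤ-Solver.solve (y ∷ []))))
    y-1≢β : y ℤ.- 1ℤ ≢ (y ℤ.+ y ℤ.- α)
    y-1≢β eq = β≢y (ℤₚ.≤-antisym (subst (ℤ._≤ y) eq (ℤₚ.i-j≤i y 1ℤ)) y≤β)
    upper : 1ℤ ℤ.+ (c ℤ.- α) ℤ.≤ (y ℤ.+ y ℤ.- α)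
    upper with b , _ , ≢β ← s α (ℤₚ.≤-refl , α≤β) α≢y (λ eq → β≢y (ℤₚ.≤-antisym (subst (ℤ._≤ y) eq α≤y) y≤β)) =
      ≤∧≢⇒+1≤ (proj₂ b) ≢β
    lower : α ℤ.≤ c ℤ.- ((y ℤ.+ y ℤ.- α) ℤ.- 1ℤ)
    lower = proj₁ (proj₁ (s ((y ℤ.+ y ℤ.- α) ℤ.- 1ℤ) (≤-by₂ 1+α≤y y≤β (ℤ-Solver.solve (α ∷ y ∷ [])) , ℤₚ.i-j≤i (y ℤ.+ y ℤ.- α) 1ℤ)
      (λ eq → +1≰ (1ℤ ℤ.+ y) (ℤₚ.≤-trans 2+y≤β (≤-by₁ (ℤₚ.≤-reflexive eq) (ℤ-Solver.solve (α ∷ y ∷ [])))))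
      (λ eq → +1≰ (y ℤ.+ y ℤ.- α) (≤-by₁ (ℤₚ.≤-reflexive (sym eq)) (ℤ-Solver.solve (α ∷ y ∷ []))))))
    c≡ : c ≡ y ℤ.+ y ℤ.- 1ℤ
    c≡ = ℤₚ.≤-antisym (≤-by₁ upper (ℤ-Solver.solve (α ∷ y ∷ c ∷ []))) (≤-by₁ lower (ℤ-Solver.solve (α ∷ y ∷ c ∷ [])))
  -- Both end points survive, so `c = 2y`; the point `c - z` is neither `y` nor `z`, yet its
  -- reflection is `z`.
  cases (no z≢α) (no z≢β) = proj₂ (proj₂ (s (c ℤ.- z)
    (subst (λ c → Between α (y ℤ.+ y ℤ.- α) (c ℤ.- z)) (trans sum≡ (sym c≡)) (between-reflect α (y ℤ.+ y ℤ.- α) z z∈))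
    c-z≢y c-z≢z)) (ℤ-Solver.solve (c ∷ z ∷ []))
    where
    sum≡ : α ℤ.+ (y ℤ.+ y ℤ.- α) ≡ y ℤ.+ y
    sum≡ = ℤ-Solver.solve (α ∷ y ∷ [])
    upper : c ℤ.- α ℤ.≤ (y ℤ.+ y ℤ.- α)
    upper = proj₂ (proj₁ (s α (ℤₚ.≤-refl , α≤β) α≢y (z≢α ∘ sym)))
    lower : α ℤ.≤ c ℤ.- (y ℤ.+ y ℤ.- α)
    lower = proj₁ (proj₁ (s (y ℤ.+ y ℤ.- α) (α≤β , ℤₚ.≤-refl) β≢y (z≢β ∘ sym)))
    c≡ : c ≡ y ℤ.+ y
    c≡ = ℤₚ.≤-antisym (≤-by₁ upper (ℤ-Solver.solve (α ∷ y ∷ c ∷ []))) (≤-by₁ lower (ℤ-Solver.solve (α ∷ y ∷ c ∷ [])))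
    c-z≢y : c ℤ.- z ≢ y
    c-z≢y eq = z≢y (begin
      z                 ≡⟨ ℤ-Solver.solve (c ∷ z ∷ []) ⟩
      c ℤ.- (c ℤ.- z)   ≡⟨ cong₂ ℤ._-_ c≡ eq ⟩
      y ℤ.+ y ℤ.- y     ≡⟨ ℤ-Solver.solve (y ∷ []) ⟩
      y                 ∎)
      where open ≡-Reasoning
    c-z≢z : c ℤ.- z ≢ z
    c-z≢z eq = z≢y (double-injective (trans (cong (ℤ._+ z) (sym eq)) (trans (i-t+t c z) c≡)))

-- The level of vWord m above h = m + 1 is {m + 1, m + 3}; its others are intervals.

Interval : ℕ → ℕ → ℤ → Set
Interval n h = Between (+ suc h) (+ n)

Notched : ℕ → ℕ → ℤ → Set
Notched m h j = (h ≡ suc m × (j ≡ + (1 + m) ⊎ j ≡ + (3 + m))) ⊎ (h ≢ suc m × Interval (3 + m) h j)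

interval-symmetric : ∀ n h → ∃ λ c → ∀ j → Interval n h j → Interval n h (c ℤ.- j)
interval-symmetric n h = + suc h ℤ.+ + n , between-reflect (+ suc h) (+ n)

notched-symmetric : ∀ m h → ∃ λ c → ∀ j → Notched m h j → Notched m h (c ℤ.- j)
notched-symmetric m h with h ≟ suc m | interval-symmetric (3 + m) h
... | no h≢ | c , s = c , λ where
    j (inj₁ (h≡ , _)) → contradiction h≡ h≢
    j (inj₂ (_ , j∈)) → inj₂ (h≢ , s j j∈)
... | yes refl | _ = + (1 + m) ℤ.+ + (3 + m) , λ where
    j (inj₁ (_ , inj₁ refl)) → inj₁ (refl , inj₂ (swap-ˡ (+ (1 + m)) (+ (3 + m))))
    j (inj₁ (_ , inj₂ refl)) → inj₁ (refl , inj₁ (i+t-t (+ (1 + m)) (+ (3 + m))))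
    j (inj₂ (h≢ , _))        → contradiction refl h≢
  where
  swap-ˡ : ∀ i j → i ℤ.+ j ℤ.- i ≡ j
  swap-ˡ = ℤ-Solver.solve-∀

shape-at-0 : ∀ {P Q : ℤ → Set} → (∀ i → (P i → Q i) × (Q i → P i)) → Translate P Q
shape-at-0 {P} {Q} e = 0ℤ , λ i → subst (λ j → (P i → Q j) × (Q j → P i)) (sym (ℤₚ.+-identityʳ i)) (e i)

interval-window : ∀ {n h i} → Interval n h i → ∃ λ k → k < n × h ≤ k × i ≡ + suc k
interval-window {i = + suc k} (ℤ.+≤+ h<k , ℤ.+≤+ k<n) = k , k<n , s≤s⁻¹ h<k , refl

id-shape : ∀ n → HasShape (Interval n) (idWord n)
id-shape n h = shape-at-0 λ i → to i , from i
  where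
  to : ∀ i → h < column (idWord n) i → Interval n h i
  to i lt with k , k<l , refl ← in-window (column-supported (idWord n) i (≤-<-trans z≤n lt))
    with k<n ← subst (k <_) (length-applyUpTo _ n) k<l =
    ℤ.+≤+ (subst (h <_) (letter-applyUpTo _ n k k<n) lt) , ℤ.+≤+ k<n
  from : ∀ i → Interval n h i → h < column (idWord n) i
  from i i∈ with k , k<n , h≤k , refl ← interval-window i∈ = subst (h <_) (sym (letter-applyUpTo _ n k k<n)) (s≤s h≤k)

length-vWord : ∀ m → length (vWord m) ≡ 3 + m
length-vWord m = trans (length-++ (idWord m)) (trans (cong (_+ 3) (length-applyUpTo _ m)) (+-comm m 3))

letter-vWord : ∀ m k → k < 3 + m → letter (vWord m) (suc k) ≡ suc (transpose m (suc m) k)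
letter-vWord m k k<n with k <? m
... | yes k<m = trans (letter-++ˡ (idWord m) _ k (subst (k <_) (sym (length-applyUpTo _ m)) k<m))
                  (trans (letter-applyUpTo _ m k k<m) (cong suc (sym (transpose-fixes m (suc m) (<⇒≢ k<m) (<⇒≢ (m<n⇒m<1+n k<m))))))
... | no k≮m = subst (λ k → letter (vWord m) (suc k) ≡ suc (transpose m (suc m) k)) (m+[n∸m]≡n (≮⇒≥ k≮m))
                 (trans (trans (cong (λ l → letter (vWord m) (suc (l + (k ∸ m)))) (sym (length-applyUpTo _ m))) (letter-++ʳ (idWord m) _ (k ∸ m)))
                   (last-three (k ∸ m) (+-cancelˡ-< m _ _ (subst₂ _<_ (sym (m+[n∸m]≡n (≮⇒≥ k≮m))) (+-comm 3 m) k<n))))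
  where
  last-three : ∀ j → j < 3 → letter (pos (2 + m) ∷ pos (1 + m) ∷ pos (3 + m) ∷ []) (suc j) ≡ suc (transpose m (suc m) (m + j))
  last-three 0 _ rewrite +-identityʳ m = cong suc (sym (transpose-ˡ m (suc m)))
  last-three 1 _ rewrite +-comm m 1    = cong suc (sym (transpose-ʳ m (suc m)))
  last-three 2 _ rewrite +-comm m 2    = cong suc (sym (transpose-fixes m (suc m) (>⇒≢ (m<n⇒m<1+n (n<1+n m))) (>⇒≢ (n<1+n (suc m)))))
  last-three (suc (suc (suc _))) (s≤s (s≤s (s≤s ())))

v-shape : ∀ m → HasShape (Notched m) (vWord m)
v-shape m h = shape-at-0 λ i → to i , from i
  where
  n = 3 + m
  to-nat : ∀ k → k < n → h ≤ transpose m (suc m) k → Notched m h (+ suc k)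
  to-nat k k<n le with h ≟ suc m | k ≟ m
  ... | yes refl | yes refl = inj₁ (refl , inj₁ refl)
  ... | no  h≢   | yes refl = inj₂ (h≢ , ℤ.+≤+ (≤∧≢⇒< le h≢) , ℤ.+≤+ k<n)
  ... | h≟       | no k≢m with k ≟ suc m
  -- Column `m + 2` has height only `m + 1`: this is the notch.
  to-nat k k<n le | yes refl | no k≢m | yes refl = contradiction le 1+n≰n
  to-nat k k<n le | yes refl | no k≢m | no k≢1+m =
    inj₁ (refl , inj₂ (cong (+_ ∘ suc) (≤-antisym (s≤s⁻¹ k<n) (≤∧≢⇒< le (k≢1+m ∘ sym)))))
  to-nat k k<n le | no h≢ | no k≢m | yes refl = inj₂ (h≢ , ℤ.+≤+ (s≤s (m≤n⇒m≤1+n le)) , ℤ.+≤+ k<n)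
  to-nat k k<n le | no h≢ | no k≢m | no k≢1+m = inj₂ (h≢ , ℤ.+≤+ (s≤s le) , ℤ.+≤+ k<n)

  from-nat : ∀ k → Notched m h (+ suc k) → h ≤ transpose m (suc m) k
  from-nat k (inj₁ (refl , inj₁ refl)) = ≤-reflexive (sym (transpose-ˡ m (suc m)))
  from-nat k (inj₁ (refl , inj₂ refl)) = ≤-trans (n≤1+n _)
    (≤-reflexive (sym (transpose-fixes m (suc m) (>⇒≢ (m<n⇒m<1+n (n<1+n m))) (>⇒≢ (n<1+n (suc m))))))
  from-nat k (inj₂ (h≢ , ℤ.+≤+ h<k , _)) with k ≟ m
  ... | yes refl = ≤-trans (s≤s⁻¹ h<k) (n≤1+n m)
  ... | no  k≢m with k ≟ suc m
  ...   | yes refl = s≤s⁻¹ (≤∧≢⇒< (s≤s⁻¹ h<k) h≢)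
  ...   | no  _    = s≤s⁻¹ h<k

  to : ∀ i → h < column (vWord m) i → Notched m h i
  to i lt with k , k<l , refl ← in-window (column-supported (vWord m) i (≤-<-trans z≤n lt))
    with k<n ← subst (k <_) (length-vWord m) k<l = to-nat k k<n (s≤s⁻¹ (subst (h <_) (letter-vWord m k k<n) lt))

  notched-window : ∀ i → Notched m h i → ∃ λ k → k < n × i ≡ + suc k
  notched-window i (inj₁ (_ , inj₁ refl)) = m , m≤n+m (suc m) 2 , refl
  notched-window i (inj₁ (_ , inj₂ refl)) = suc (suc m) , ≤-refl , refl
  notched-window i (inj₂ (_ , i∈)) with k , k<n , _ , eq ← interval-window i∈ = k , k<n , eq

  from : ∀ i → Notched m h i → h < column (vWord m) i
  from i nt with k , k<n , refl ← notched-window i nt = subst (h <_) (sym (letter-vWord m k k<n)) (s≤s (from-nat k nt))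

-- Permutations

id∈𝒮 : ∀ n → 𝒮 n (idWord n)
id∈𝒮 n = ↭-reflexive (map-applyUpTo _ value n)

v∈𝒮 : ∀ m → 𝒮 (3 + m) (vWord m)
v∈𝒮 m = ↭-trans (↭-reflexive (trans (map-++ value (idWord m) _) (cong (_++ (2 + m ∷ 1 + m ∷ 3 + m ∷ [])) (map-applyUpTo _ value m))))
  (↭-trans (++⁺ˡ (applyUpTo suc m) (swap (2 + m) (1 + m) ↭-refl)) (↭-reflexive (begin
    applyUpTo suc m ++ (1 + m ∷ 2 + m ∷ 3 + m ∷ [])                ≡⟨ ++-assoc (applyUpTo suc m) (1 + m ∷ []) _ ⟨
    (applyUpTo suc m ++ 1 + m ∷ []) ++ (2 + m ∷ 3 + m ∷ [])        ≡⟨ cong (_++ (2 + m ∷ 3 + m ∷ [])) (applyUpTo-∷ʳ suc m) ⟩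
    applyUpTo suc (1 + m) ++ (2 + m ∷ 3 + m ∷ [])                  ≡⟨ ++-assoc (applyUpTo suc (1 + m)) (2 + m ∷ []) _ ⟨
    (applyUpTo suc (1 + m) ++ 2 + m ∷ []) ++ (3 + m ∷ [])          ≡⟨ cong (_++ (3 + m ∷ [])) (applyUpTo-∷ʳ suc (1 + m)) ⟩
    applyUpTo suc (2 + m) ++ (3 + m ∷ [])                          ≡⟨ applyUpTo-∷ʳ suc (2 + m) ⟩
    applyUpTo suc (3 + m)                                          ∎)))
  where open ≡-Reasoning

𝒮-length : ∀ {n} → 𝒮 n u → length u ≡ n
𝒮-length {u} {n} p = trans (sym (length-map value u)) (trans (↭-length p) (length-applyUpTo suc n))

∈-letters : ∀ u {x} → x ∈ₗ map value u → ∃ λ k → letter u (suc k) ≡ x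
∈-letters (a ∷ u) (here refl) = 0 , refl
∈-letters (a ∷ u) (there x∈) with k , eq ← ∈-letters u x∈ = suc k , eq

letter-∈ : ∀ u k → k < length u → letter u (suc k) ∈ₗ map value u
letter-∈ (a ∷ u) zero    _   = here refl
letter-∈ (a ∷ u) (suc k) k<u = there (letter-∈ u k (s<s⁻¹ k<u))

unique-letters : ∀ u → Unique (map value u) → ∀ j k → j < length u → k < length u →
                 letter u (suc j) ≡ letter u (suc k) → j ≡ k
unique-letters (a ∷ u) _         zero    zero    _   _   _  = refl
unique-letters (a ∷ u) (a∉ AllPairs.∷ _)  zero    (suc k) _   k<u eq = contradiction eq (All.lookup a∉ (letter-∈ u k (s<s⁻¹ k<u)))
unique-letters (a ∷ u) (a∉ AllPairs.∷ _)  (suc j) zero    j<u _   eq = contradiction (sym eq) (All.lookup a∉ (letter-∈ u j (s<s⁻¹ j<u)))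
unique-letters (a ∷ u) (_ AllPairs.∷ uni) (suc j) (suc k) j<u k<u eq = cong suc (unique-letters u uni j k (s<s⁻¹ j<u) (s<s⁻¹ k<u) eq)

module Letters {n} (p : 𝒮 n u) where
  position : ∀ k → k < n → ∃ λ i → column u i ≡ suc k
  position k k<n with j , eq ← ∈-letters u (∈-resp-↭ (↭-sym p) (∈-applyUpTo⁺ suc k<n)) = + suc j , eq

  bounded : ∀ i → column u i ≤ n
  bounded i with 0 <? column u i
  ... | no  ≮ = ≤-trans (≮⇒≥ ≮) z≤n
  ... | yes lt with k , k<u , refl ← in-window (column-supported u i lt)
    with x , x<n , eq ← ∈-applyUpTo⁻ suc (∈-resp-↭ p (letter-∈ u k k<u)) = subst (_≤ n) (sym eq) x<n

  unique : ∀ {i j k} → column u i ≡ suc k → column u j ≡ suc k → i ≡ j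
  unique {i} {j} {k} eqᵢ eqⱼ
    with a , a<u , refl ← in-window (column-supported u i (subst (0 <_) (sym eqᵢ) z<s))
    with b , b<u , refl ← in-window (column-supported u j (subst (0 <_) (sym eqⱼ) z<s)) =
    cong (+_ ∘ suc) (unique-letters u (Permutationₛ.Unique-resp-↭ (setoid ℕ) (↭⇒↭ₛ (↭-sym p))
      (applyUpTo⁺₁ suc n λ i<j _ → <⇒≢ (s<s i<j))) a b a<u b<u (trans eqᵢ (sym eqⱼ)))

-- The only way for a level that is an interval to be followed by a symmetric
-- level that is not one is to lose its midpoint; the next level then cannot be
-- symmetric unless the interval had three elements.
module _ {m} (p : 𝒮 (3 + m) u) (sy : Symmetric u) where
  open Letters {u} p
  private
    n = 3 + m

    Good : ℕ → Set
    Good h = Translate (Above h u) (Interval n h)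

    Ends : ℤ → Set
    Ends j = j ≡ + (1 + m) ⊎ j ≡ + (3 + m)

    Corner : Set
    Corner = Translate (Above (suc m) u) Ends

    good-empty : ∀ h → n ≤ h → Good h
    good-empty h n≤h = shape-at-0 {Above h u} {Interval n h} λ i →
      (λ lt → contradiction (bounded i) (<⇒≱ (≤-<-trans n≤h lt))) ,
      (λ (h<i , i≤n) → contradiction (ℤₚ.drop‿+≤+ (ℤₚ.≤-trans h<i i≤n)) (<⇒≱ (s≤s n≤h)))

    -- Only the largest letter lies above `2 + m`. This supplies the level that follows a corner,
    -- where `chain` has already stopped.
    good-singleton : Good (2 + m)
    good-singleton with x , ax ← position (2 + m) ≤-refl = + n ℤ.- x , λ i →
      (λ lt → subst (Interval n (2 + m)) (sym (centre (+ n) x i (unique (≤-antisym (bounded i) lt) ax))) (ℤₚ.≤-refl , ℤₚ.≤-refl)) ,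
      (λ (n≤ , ≤n) → ≤-reflexive (sym (trans (cong (column u) (centre⁻¹ (+ n) x i (ℤₚ.≤-antisym ≤n n≤))) ax)))
      where
      centre : ∀ n x i → i ≡ x → i ℤ.+ (n ℤ.- x) ≡ n
      centre n x i refl = ℤ-Solver.solve (n ∷ i ∷ [])
      centre⁻¹ : ∀ n x i → i ℤ.+ (n ℤ.- x) ≡ n → i ≡ x
      centre⁻¹ n x i eq = trans (regroup n x i) (trans (cong (λ j → j ℤ.- n ℤ.+ x) eq) (cancel n x))
        where
        regroup : ∀ n x i → i ≡ i ℤ.+ (n ℤ.- x) ℤ.- n ℤ.+ x
        regroup = ℤ-Solver.solve-∀
        cancel : ∀ n x → n ℤ.- n ℤ.+ x ≡ x
        cancel = ℤ-Solver.solve-∀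

    t-injective : ∀ i j t → i ℤ.+ t ≡ j ℤ.+ t → i ≡ j
    t-injective i j t eq = trans (sym (i+t-t i t)) (trans (cong (ℤ._- t) eq) (i+t-t j t))

    -- Each letter occurs once, so going up one level removes exactly one position.
    remove : ∀ {h x i} → column u x ≡ suc h →
             (suc h < column u i → (h < column u i) × (i ≢ x)) × (h < column u i → i ≢ x → suc h < column u i)
    remove {h} {x} {i} ax =
      (λ lt → <-trans (n<1+n h) lt , λ { refl → n≮n _ (subst (suc h <_) ax lt) }) ,
      (λ lt i≢x → ≤∧≢⇒< lt (λ eq → i≢x (unique (sym eq) ax)))

    -- The symmetry of a level, rewritten in the coordinates `j = i + t` in which a level becomes an
    -- interval ending at `n`.
    reflected : ∀ h t → ∃ λ c → ∀ j → h < column u (j ℤ.- t) → h < column u (c ℤ.- j ℤ.- t)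
    reflected h t with c , s ← sy h = c ℤ.+ t ℤ.+ t , λ j lt → subst (λ i → h < column u i) (regroup c t j) (s (j ℤ.- t) lt)
      where
      regroup : ∀ c t j → c ℤ.- (j ℤ.- t) ≡ c ℤ.+ t ℤ.+ t ℤ.- j ℤ.- t
      regroup = ℤ-Solver.solve-∀

    module Step {h t} (1+h<n : suc h < n)
                (e : ∀ i → (h < column u i → Interval n h (i ℤ.+ t)) × (Interval n h (i ℤ.+ t) → h < column u i)) where
      -- In the coordinates `i + t` the level above `h` runs from `α` to `β`, and the next level
      -- loses `y`, the place of the letter `suc h`.
      α β x y : ℤ
      α = + suc h
      β = + n
      x = proj₁ (position h (<-trans (n<1+n h) 1+h<n))
      y = x ℤ.+ t

      ax : column u x ≡ suc h
      ax = proj₂ (position h (<-trans (n<1+n h) 1+h<n))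

      y∈ : Between α β y
      y∈ = proj₁ (e x) (≤-reflexive (sym ax))

      level : ∀ i → (suc h < column u i → Between α β (i ℤ.+ t) × (i ℤ.+ t ≢ y)) × (Between α β (i ℤ.+ t) → i ℤ.+ t ≢ y → suc h < column u i)
      level i =
        (λ lt → let lt′ , i≢x = proj₁ (remove {i = i} ax) lt in proj₁ (e i) lt′ , i≢x ∘ t-injective i x t) ,
        (λ j∈ j≢y → proj₂ (remove {i = i} ax) (proj₂ (e i) j∈) (j≢y ∘ cong (ℤ._+ t)))

      level′ : ∀ j → (suc h < column u (j ℤ.- t) → Between α β j × (j ≢ y)) × (Between α β j → j ≢ y → suc h < column u (j ℤ.- t))
      level′ j = subst (λ k → (suc h < column u (j ℤ.- t) → Between α β k × (k ≢ y)) × (Between α β k → k ≢ y → suc h < column u (j ℤ.- t)))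
        (i-t+t j t) (level (j ℤ.- t))

      lose-left : y ≡ α → Good (suc h)
      lose-left y≡α = t , λ i →
        (λ lt → let (α≤ , ≤β) , ≢y = proj₁ (level i) lt in ≤∧≢⇒+1≤ α≤ (λ eq → ≢y (trans (sym eq) (sym y≡α))) , ≤β) ,
        (λ (α< , ≤β) → proj₂ (level i) (ℤₚ.≤-trans (ℤₚ.i≤suc[i] α) α< , ≤β) (λ eq → +1≰ α (subst (λ j → 1ℤ ℤ.+ α ℤ.≤ j) (trans eq y≡α) α<)))

      -- What remains ends at `n - 1`, and one more unit of translation makes it end at `n`.
      lose-right : y ≡ β → Good (suc h)
      lose-right y≡β = 1ℤ ℤ.+ t , λ i → subst (λ j → (suc h < column u i → Interval n (suc h) j) × (Interval n (suc h) j → suc h < column u i))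
        (sym (regroup i t))
        ((λ lt → let (α≤ , ≤β) , ≢y = proj₁ (level i) lt in ℤₚ.suc-mono α≤ , ≤∧≢⇒+1≤ ≤β (λ eq → ≢y (trans eq (sym y≡β)))) ,
         (λ (α≤ , <β) → proj₂ (level i) (≤-by₁ α≤ (cancel (i ℤ.+ t) α) , ℤₚ.≤-trans (ℤₚ.i≤suc[i] _) <β)
                          (λ eq → +1≰ β (subst (λ j → 1ℤ ℤ.+ j ℤ.≤ β) (trans eq y≡β) <β))))
        where
        regroup : ∀ i t → i ℤ.+ (1ℤ ℤ.+ t) ≡ 1ℤ ℤ.+ (i ℤ.+ t)
        regroup = ℤ-Solver.solve-∀
        cancel : ∀ i a → 1ℤ ℤ.+ i ℤ.- (1ℤ ℤ.+ a) ≡ i ℤ.- a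
        cancel = ℤ-Solver.solve-∀

      centre : y ≢ α → y ≢ β → y ℤ.+ y ≡ α ℤ.+ β
      centre y≢α y≢β with c , s ← reflected (suc h) t = punctured-centre y∈ y≢α y≢β c
        (λ j j∈ j≢y → proj₁ (level′ (c ℤ.- j)) (s j (proj₂ (level′ j) j∈ j≢y)))

      -- If the midpoint is `1 + α`, then `β = 2 + α`, which reads `n = h + 3`.
      corner : y ≡ 1ℤ ℤ.+ α → y ℤ.+ y ≡ α ℤ.+ β → h ≡ m × Corner
      corner y≡ y+y≡ = h≡m , subst (λ k → Translate (Above (suc k) u) Ends) h≡m (t , λ i →
          (λ lt → let j∈ , j≢y = proj₁ (level i) lt in ends (i ℤ.+ t) j∈ j≢y) ,
          (λ where
            (inj₁ eq) → proj₂ (level i) (subst (Between α β) (sym (trans eq (cong (+_ ∘ suc) (sym h≡m)))) (ℤₚ.≤-refl , α≤β))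
                          (λ eq′ → +1≰ α (ℤₚ.≤-reflexive (trans (sym y≡) (trans (sym eq′) (trans eq (cong (+_ ∘ suc) (sym h≡m)))))))
            (inj₂ eq) → proj₂ (level i) (subst (Between α β) (sym eq) (α≤β , ℤₚ.≤-refl))
                          (λ eq′ → +1≰ (1ℤ ℤ.+ α) (ℤₚ.≤-reflexive (trans (sym β≡) (trans (sym eq) (trans eq′ y≡)))))))
        where
        β≡ : β ≡ 1ℤ ℤ.+ (1ℤ ℤ.+ α)
        β≡ = trans (regroup β α) (trans (cong (ℤ._- α) (trans (sym y+y≡) (cong₂ ℤ._+_ y≡ y≡))) (regroup′ α))
          where
          regroup : ∀ b a → b ≡ a ℤ.+ b ℤ.- a
          regroup = ℤ-Solver.solve-∀
          regroup′ : ∀ a → 1ℤ ℤ.+ a ℤ.+ (1ℤ ℤ.+ a) ℤ.- a ≡ 1ℤ ℤ.+ (1ℤ ℤ.+ a)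
          regroup′ = ℤ-Solver.solve-∀
        h≡m : h ≡ m
        h≡m = sym (suc-injective (suc-injective (suc-injective (ℤₚ.+-injective β≡))))
        α≤β : α ℤ.≤ β
        α≤β = ℤₚ.≤-trans (proj₁ y∈) (proj₂ y∈)
        ends : ∀ j → Between α β j → j ≢ y → Ends j
        ends j (α≤j , j≤β) j≢y with j ℤₚ.≟ α
        ... | yes j≡α = inj₁ (trans j≡α (cong (+_ ∘ suc) h≡m))
        ... | no  j≢α = inj₂ (ℤₚ.≤-antisym j≤β (subst (ℤ._≤ j) (sym β≡)
                          (≤∧≢⇒+1≤ (≤∧≢⇒+1≤ α≤j (j≢α ∘ sym)) (λ eq → j≢y (trans (sym eq) (sym y≡))))))

      -- The letter `suc (suc h)` is removed next, at `z`, and `twice-punctured` refutes the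
      -- symmetry of what is left.
      no-wider : y ≢ α → y ≢ 1ℤ ℤ.+ α → ¬ (y ℤ.+ y ≡ α ℤ.+ β)
      no-wider y≢α y≢1+α y+y≡ with z , az ← position (suc h) 1+h<n | c , s ← reflected (suc (suc h)) t =
        twice-punctured (≤∧≢⇒+1≤ (≤∧≢⇒+1≤ (proj₁ y∈) (y≢α ∘ sym)) (y≢1+α ∘ sym))
          (trans (regroup α β) (cong (ℤ._- α) (sym y+y≡))) (proj₁ z-level) (proj₂ z-level) c
          (λ j j∈ j≢y j≢z → below (c ℤ.- j) (s j (proj₂ (remove {x = z} {j ℤ.- t} az) (proj₂ (level′ j) j∈ j≢y)
            (λ eq → j≢z (trans (sym (i-t+t j t)) (cong (ℤ._+ t) eq))))))
        where
        regroup : ∀ a b → b ≡ a ℤ.+ b ℤ.- a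
        regroup = ℤ-Solver.solve-∀
        z-level : Between α β (z ℤ.+ t) × (z ℤ.+ t ≢ y)
        z-level = proj₁ (level z) (≤-reflexive (sym az))
        below : ∀ j → suc (suc h) < column u (j ℤ.- t) → Between α β j × (j ≢ y) × (j ≢ z ℤ.+ t)
        below j lt = let lt′ , ≢z = proj₁ (remove {x = z} {j ℤ.- t} az) lt ; j∈ , j≢y = proj₁ (level′ j) lt′ in
          j∈ , j≢y , λ eq → ≢z (trans (cong (ℤ._- t) eq) (i+t-t z t))

    step : ∀ h → suc h < n → Good h → Good (suc h) ⊎ (h ≡ m × Corner)
    step h 1+h<n (t , e) = cases (y ℤₚ.≟ α) (y ℤₚ.≟ β) (y ℤₚ.≟ 1ℤ ℤ.+ α)
      where
      open Step 1+h<n e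
      cases : Dec (y ≡ α) → Dec (y ≡ β) → Dec (y ≡ 1ℤ ℤ.+ α) → Good (suc h) ⊎ (h ≡ m × Corner)
      cases (yes y≡α) _         _         = inj₁ (lose-left y≡α)
      cases (no  _)   (yes y≡β) _         = inj₁ (lose-right y≡β)
      cases (no  y≢α) (no  y≢β) (yes y≡)  = inj₂ (corner y≡ (centre y≢α y≢β))
      cases (no  y≢α) (no  y≢β) (no  y≢)  = contradiction (centre y≢α y≢β) (no-wider y≢α y≢)

    -- Climbs from level 0, the full window, and stops at a corner. By `step` a corner can only
    -- follow level `m`, so the levels up to `m` are intervals in that case.
    chain : ∀ k → k < n → (∀ h → h ≤ k → Good h) ⊎ (Corner × (∀ h → h ≤ m → Good h))
    chain zero    _ = inj₁ λ { zero z≤n → shape-at-0 λ i →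
      (λ lt → subst (i ∈[1⋯_]) (𝒮-length {u} p) (column-supported u i lt)) ,
      (λ i∈ → column-pos u (subst (i ∈[1⋯_]) (sym (𝒮-length {u} p)) i∈)) }
    chain (suc k) 1+k<n with chain k (<-trans (n<1+n k) 1+k<n)
    ... | inj₂ found = inj₂ found
    ... | inj₁ good with step k 1+k<n (good k ≤-refl)
    ...   | inj₂ (refl , corner) = inj₂ (corner , good)
    ...   | inj₁ next = inj₁ extended
      where
      extended : ∀ h → h ≤ suc k → Good h
      extended h h≤1+k with m≤n⇒m<n∨m≡n h≤1+k
      ... | inj₁ h<1+k = good h (s≤s⁻¹ h<1+k)
      ... | inj₂ refl  = next

  symmetric⇒shape : HasShape (Interval (3 + m)) u ⊎ HasShape (Notched m) u
  symmetric⇒shape with chain (2 + m) ≤-refl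
  ... | inj₁ good = inj₁ shape
    where
    shape : HasShape (Interval n) u
    shape h with h ≤? 2 + m
    ... | yes h≤ = good h h≤
    ... | no  h≰ = good-empty h (≰⇒> h≰)
  ... | inj₂ ((t₀ , corner) , good) = inj₂ shape
    where
    notch : ∀ {h} → h ≢ suc m → Good h → Translate (Above h u) (Notched m h)
    notch h≢ (t , e) = t , λ i → (λ lt → inj₂ (h≢ , proj₁ (e i) lt)) , λ where
      (inj₁ (h≡ , _)) → contradiction h≡ h≢
      (inj₂ (_ , j∈)) → proj₂ (e i) j∈
    shape : HasShape (Notched m) u
    shape h with h ≟ suc m
    ... | yes refl = t₀ , λ i → (λ lt → inj₁ (refl , proj₁ (corner i) lt)) , λ where
      (inj₁ (_ , ends)) → proj₂ (corner i) ends
      (inj₂ (h≢ , _))   → contradiction refl h≢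
    ... | no h≢ with <-cmp h (suc m)
    ...   | tri< h<1+m _ _ = notch h≢ (good h (s≤s⁻¹ h<1+m))
    ...   | tri≈ _ h≡ _    = contradiction h≡ h≢
    ...   | tri> _ _ 1+m<h with m≤n⇒m<n∨m≡n 1+m<h
    ...     | inj₁ n≤h  = notch h≢ (good-empty h n≤h)
    ...     | inj₂ refl = notch h≢ good-singleton

-- Permutations equivalent to their reversals

id-≈reverse : ∀ n → idWord n ≈ reverse (idWord n)
id-≈reverse n = symmetric⇒≈reverse (shape⇒symmetric {idWord n} {Interval n} (id-shape n) (interval-symmetric n))

v-≈reverse : ∀ m → vWord m ≈ reverse (vWord m)
v-≈reverse m = symmetric⇒≈reverse (shape⇒symmetric {vWord m} {Notched m} (v-shape m) (notched-symmetric m))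

≈reverse-transfer : u ≈ v → v ≈ reverse v → u ≈ reverse u
≈reverse-transfer u≈v v≈ = ≈-trans u≈v (≈-trans v≈ (≈-sym (≈-reverse u≈v)))

≈reverse⇒id-or-v : ∀ m → 𝒮 (3 + m) u → u ≈ reverse u → (u ≈ idWord (3 + m)) ⊎ (u ≈ vWord m)
≈reverse⇒id-or-v {u} m p u≈ with symmetric⇒shape {u} p (≈reverse⇒symmetric u≈)
... | inj₁ shape = inj₁ (same-shape⇒≈ {u} {idWord (3 + m)} {Interval (3 + m)} shape (id-shape (3 + m))
    (trans (𝒮-length {u} p) (sym (𝒮-length {idWord (3 + m)} (id∈𝒮 (3 + m))))))
... | inj₂ shape = inj₂ (same-shape⇒≈ {u} {vWord m} {Notched m} shape (v-shape m) (trans (𝒮-length {u} p) (sym (length-vWord m))))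

-- Shift classes

-- Reversal respects `≈` and is an involution, so only the parity of the number of reversals in the
-- chain matters.
∼sh⇒≈ : u ∼sh w → (u ≈ w) ⊎ (reverse u ≈ w)
∼sh⇒≈ {u} ε = inj₁ record { length-≡ = refl ; levels = λ h → shape-at-0 {Above h u} {Above h u} (λ _ → id , id) }
∼sh⇒≈ {u} {w} (_◅_ {j = v} (inj₁ (_ , _ , r)) rs) with u≈v ← lifted⇒≈ (rigid⇒lifted r) | ∼sh⇒≈ rs
... | inj₁ v≈w = inj₁ (≈-trans u≈v v≈w)
... | inj₂ rev≈w = inj₂ (≈-trans (≈-reverse u≈v) rev≈w)
∼sh⇒≈ {u} {w} (inj₂ refl ◅ rs) with ∼sh⇒≈ rs
... | inj₁ rev≈w = inj₂ rev≈w
... | inj₂ u≈w   = inj₁ (subst (_≈ w) (reverse-involutive u) u≈w)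

≈⇒∼sh : u ≈ w → u ∼sh w
≈⇒∼sh u≈w = Star.map inj₁ (≈⇒rigid* u≈w)

reverse-≈⇒∼sh : reverse u ≈ w → u ∼sh w
reverse-≈⇒∼sh rev≈w = inj₂ refl ◅ ≈⇒∼sh rev≈w

𝒮-∼ss⇒≈ : ∀ {n} → 𝒮 n u → 𝒮 n v → u ∼ss v → u ≈ v
𝒮-∼ss⇒≈ {u} {v} p q = ∼ss⇒≈ {u} {v} (↭-trans p (↭-sym q))

-- A shift class is taken among all words; equal level sizes keep its members inside `𝒮 n`.
≈⇒ss-in : ∀ {n} → 𝒮 n u → u ≈ w → ([ u ]ss-in n) w
≈⇒ss-in p u≈w = ↭-trans (↭-sym (≈⇒↭ u≈w)) p , ≈⇒∼ss u≈w

𝒮-reverse : ∀ {n} → 𝒮 n u → 𝒮 n (reverse u)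
𝒮-reverse {u} p = ↭-trans (map⁺ value (↭-reverse u)) p

mainTheorem13 : (m : ℕ) → let n = 3 + m in
    (u : Word) → u ∈ 𝒮 n →
    ((u ∼ss idWord n) ⊎ (u ∼ss vWord m) → [ u ]sh ≐ ([ u ]ss-in n)) ×
    (¬ ((u ∼ss idWord n) ⊎ (u ∼ss vWord m)) →
    ([ u ]sh ≐ (([ u ]ss-in n) ∪ ([ reverse u ]ss-in n))) ×
    (([ u ]ss-in n) ⊥ ([ reverse u ]ss-in n)))
mainTheorem13 m u p =
  (λ ss → (λ {w} → self-reverse ss {w}) , λ {w} (q , ss′) → ≈⇒∼sh (𝒮-∼ss⇒≈ {u} {w} p q ss′)) ,
  (λ ¬ss → ((λ {w} → split {w}) , (λ {w} → merge {w})) , λ {w} → disjoint ¬ss {w})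
  where
  n = 3 + m
  rev-p = 𝒮-reverse {u} p

  ≈reverse : (u ∼ss idWord n) ⊎ (u ∼ss vWord m) → u ≈ reverse u
  ≈reverse (inj₁ ss) = ≈reverse-transfer (𝒮-∼ss⇒≈ {u} {idWord n} p (id∈𝒮 n) ss) (id-≈reverse n)
  ≈reverse (inj₂ ss) = ≈reverse-transfer (𝒮-∼ss⇒≈ {u} {vWord m} p (v∈𝒮 m) ss) (v-≈reverse m)

  self-reverse : (u ∼ss idWord n) ⊎ (u ∼ss vWord m) → ∀ {w} → u ∼sh w → ([ u ]ss-in n) w
  self-reverse ss sh with ∼sh⇒≈ sh
  ... | inj₁ u≈w   = ≈⇒ss-in p u≈w
  ... | inj₂ rev≈w = ≈⇒ss-in p (≈-trans (≈reverse ss) rev≈w)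

  split : ∀ {w} → u ∼sh w → (([ u ]ss-in n) ∪ ([ reverse u ]ss-in n)) w
  split sh with ∼sh⇒≈ sh
  ... | inj₁ u≈w   = inj₁ (≈⇒ss-in p u≈w)
  ... | inj₂ rev≈w = inj₂ (≈⇒ss-in rev-p rev≈w)

  merge : ∀ {w} → (([ u ]ss-in n) ∪ ([ reverse u ]ss-in n)) w → u ∼sh w
  merge {w} (inj₁ (q , ss)) = ≈⇒∼sh (𝒮-∼ss⇒≈ {u} {w} p q ss)
  merge {w} (inj₂ (q , ss)) = reverse-≈⇒∼sh (𝒮-∼ss⇒≈ {reverse u} {w} rev-p q ss)

  disjoint : ¬ ((u ∼ss idWord n) ⊎ (u ∼ss vWord m)) → ([ u ]ss-in n) ⊥ ([ reverse u ]ss-in n)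
  -- A common member `w` would give `u ≈ w ≈ reverse u`, and then `u` would be equivalent to one of
  -- the two exceptional permutations.
  disjoint ¬ss {w} ((q , ss) , (_ , ss′)) = ¬ss (Sum.map ≈⇒∼ss ≈⇒∼ss (≈reverse⇒id-or-v m p u≈reverse))
    where
    u≈reverse : u ≈ reverse u
    u≈reverse = ≈-trans (𝒮-∼ss⇒≈ {u} {w} p q ss) (≈-sym (𝒮-∼ss⇒≈ {reverse u} {w} rev-p q ss′))
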